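{- Let $n\ge 3$ be an integer. Let $\mathcal{R}$ be a system of representatives (in integers coprime to $n$) of the group $(\mathbb{Z}/n\mathbb{Z})^{\times}/\{\pm 1\}$, ordered in some fixed way. For an integer $k$ with $\gcd(k,n)=1$, let $k^*$ denote an integer with $kk^*\equiv 1 \pmod n$, and put $c_k=2\cos(2\pi k/n)$. Define the cosine matrix $C=(c_{jk^*})_{j,k\in\mathcal{R}}$. For integers $k$ with $\gcd(k,n)=1$ define $$\lambda(k)=\#\{q\in\mathbb{N} : q\ge 3,\ q\mid n,\ k\equiv 1 \pmod q\},$$ let $\rho_n=2$ if $n$ is odd and $\rho_n=4$ if $n$ is even, and put $$\widehat{c}_k=\frac1n\sum_{l\in\mathcal{R}}\bigl(\lambda(lk)+\lambda(-lk)+\rho_n\bigr)c_l .$$ Then $C$ is invertible if and only if $n$ is square-free. In this case $$C^{ -1}=(\widehat{c}_{jk^*})_{j,k\in\mathcal{R}}.$$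
   Context: The quantities $c_{jk^*}$ and $\widehat c_{jk^*}$ depend only on $jk^*$ modulo $n$, so they do not depend on the choice of the inverse $k^*$. -}

module Defs where

open import Level using (_⊔_)
open import Algebra.Bundles using (CommutativeRing)
open import Data.Nat as ℕ using (ℕ; zero; suc; _≤_; _<_)
import Data.Nat.Properties as ℕP
open import Data.Nat.Divisibility as ℕD using ()
open import Data.Nat.Coprimality using (Coprime)
open import Data.Integer as ℤ using (ℤ; +_; ∣_∣)
open import Data.Integer.Divisibility.Signed as ℤD using ()
open import Data.Fin as Fin using (Fin)
open import Data.List using (List; length; filter; upTo)
open import Data.Product using (_×_; ∃)
open import Data.Sum using (_⊎_)
open import Relation.Nullary using (¬_; Dec; yes; no)
open import Relation.Nullary.Decidable using (_×-dec_)
open import Relation.Binary.PropositionalEquality using (_≡_)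

_≡_[mod_] : ℤ → ℤ → ℕ → Set
a ≡ b [mod n ] = (+ n) ℤD.∣ (a ℤ.- b)

_≡±_[mod_] : ℤ → ℤ → ℕ → Set
a ≡± b [mod n ] = (a ≡ b [mod n ]) ⊎ (a ≡ ℤ.- b [mod n ])

CoprimeTo : ℤ → ℕ → Set
CoprimeTo k n = Coprime ∣ k ∣ n

SquareFree : ℕ → Set
SquareFree n = ∀ d → 2 ≤ d → ¬ ((d ℕ.* d) ℕD.∣ n)

IsRepSystem : (n m : ℕ) → (Fin m → ℤ) → Set
IsRepSystem n m r =
  (∀ i → CoprimeTo (r i) n) ×
  (∀ i j → r i ≡± r j [mod n ] → i ≡ j) ×
  (∀ u → CoprimeTo u n → ∃ λ i → r i ≡± u [mod n ])

-- k mod n as a natural number (n = 0 never used)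
modN : ℤ → ℕ → ℕ
modN k zero = 0
modN k (suc n) = k ℤ.%ℕ suc n

-- λ(k) = #{ q ∈ ℕ : q ≥ 3, q ∣ n, k ≡ 1 (mod q) }
-- (such q satisfy q ≤ n when n ≥ 1, so counting over 0..n suffices)
λ-cond : ℕ → ℤ → ℕ → Set
λ-cond n k q = (3 ≤ q) × (q ℕD.∣ n) × (k ≡ ℤ.1ℤ [mod q ])

λ-cond? : ∀ n k q → Dec (λ-cond n k q)
λ-cond? n k q = (3 ℕ.≤? q) ×-dec ((q ℕD.∣? n) ×-dec ((+ q) ℤD.∣? (k ℤ.- ℤ.1ℤ)))

lam : ℕ → ℤ → ℕ
lam n k = length (filter (λ-cond? n k) (upTo (suc n)))

ρ : ℕ → ℕ
ρ n with n ℕ.% 2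
... | zero = 4
... | suc _ = 2

module _ {c ℓ} (F : CommutativeRing c ℓ) where
  open CommutativeRing F

  IsField : Set (c ⊔ ℓ)
  IsField = (¬ (1# ≈ 0#)) × (∀ x → ¬ (x ≈ 0#) → ∃ λ y → x * y ≈ 1#)

  fromℕ : ℕ → Carrier
  fromℕ zero = 0#
  fromℕ (suc k) = 1# + fromℕ k

  CharZero : Set ℓ
  CharZero = ∀ k → ¬ (fromℕ (suc k) ≈ 0#)

  pow : Carrier → ℕ → Carrier
  pow x zero = 1#
  pow x (suc k) = x * pow x k

  IsPrimitiveRoot : ℕ → Carrier → Set ℓ
  IsPrimitiveRoot n ζ = (pow ζ n ≈ 1#) × (∀ d → 0 < d → d < n → ¬ (pow ζ d ≈ 1#))

  -- c_k = ζ^k + ζ^{-k}   (= 2 cos(2πk/n) when ζ = e^{2πi/n})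
  cosC : ℕ → Carrier → ℤ → Carrier
  cosC n ζ k = pow ζ (modN k n) + pow ζ (modN (ℤ.- k) n)

  sumF : (m : ℕ) → (Fin m → Carrier) → Carrier
  sumF zero f = 0#
  sumF (suc m) f = f Fin.zero + sumF m (λ i → f (Fin.suc i))

  Matrix : ℕ → Set c
  Matrix m = Fin m → Fin m → Carrier

  mmul : (m : ℕ) → Matrix m → Matrix m → Matrix m
  mmul m A B i j = sumF m (λ k → A i k * B k j)

  idM : (m : ℕ) → Matrix m
  idM m i j with i Fin.≟ j
  ... | yes _ = 1#
  ... | no _ = 0#

  IsInverse : (m : ℕ) → Matrix m → Matrix m → Set ℓ
  IsInverse m A B = (∀ i j → mmul m A B i j ≈ idM m i j) × (∀ i j → mmul m B A i j ≈ idM m i j)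

  Invertible : (m : ℕ) → Matrix m → Set (c ⊔ ℓ)
  Invertible m A = ∃ λ B → IsInverse m A B

  -- the cosine matrix C = (c_{j k*})_{j,k ∈ R}
  cosMatrix : (n m : ℕ) → Carrier → (r s : Fin m → ℤ) → Matrix m
  cosMatrix n m ζ r s j k = cosC n ζ (r j ℤ.* s k)

  cHat : (n m : ℕ) → Carrier → (r : Fin m → ℤ) → (ninv : Carrier) → ℤ → Carrier
  cHat n m ζ r ninv k =
    ninv * sumF m (λ l → fromℕ (lam n (r l ℤ.* k) ℕ.+ lam n (ℤ.- (r l ℤ.* k)) ℕ.+ ρ n) * cosC n ζ (r l))

  cHatMatrix : (n m : ℕ) → Carrier → (r s : Fin m → ℤ) → Carrier → Matrix m
  cHatMatrix n m ζ r s ninv j k = cHat n m ζ r ninv (r j ℤ.* s k)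

{-# OPTIONS --safe #-}
module Submission where

-- Summing f(k) + f(- k) over the representatives is summing f over all units a mod n, and
-- λ(k) + λ(- k) + ρ_n = μ(k) + μ(- k) where μ(k) counts all q ∣ n with k ≡ 1 (mod q).  With
-- c_k = e(k) + e(- k), the entries of C Ĉ thereby reduce to n⁻¹ ∑_a μ(a) (R(t - a) + R(t + a)), where
-- a runs over the units and R(x) = ∑_b e(b x) is the Ramanujan sum.  For square-free n let
-- ν_p(a) = [a ≡ 1 (p)] - [a ≡ 0 (p)] and ν = ∏_p ν_p; then the indicator of the units times μ is
-- ∏_p (1 + ν_p).  Its Fourier transform agrees with that of ν at units, because functions periodic
-- modulo a proper divisor of n have no Fourier coefficient there; and that of ν vanishes at a
-- non-unit b, because for p ∣ b some shift fixing a ↦ e(a b) exchanges the two indicators in ν_p.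
-- Fourier inversion gives ∑_a μ(a) R(t - a) = n ν(t) = n [t ≡ 1 (n)] for units t.
-- If d² ∣ n with d ≥ 2, the rows of C belonging to the d units 1 + (n/d) i add up to zero.

open import Defs
open import Level using (Level)
open import Algebra.Bundles using (CommutativeRing)
open import Data.Nat using (ℕ; _≤_)
open import Data.Integer using (ℤ)
open import Data.Fin using (Fin)
open import Data.Product using (_×_)
open import Function.Bundles using (_⇔_)

import Algebra.Properties.Ring as RingProperties
import Algebra.Properties.Semiring.Sum as SemiringSum
import Algebra.Solver.Ring.NaturalCoefficients.Default as SemiringSolver
open import Data.Empty using (⊥-elim)
import Data.Fin as Fin
open import Data.Fin using (toℕ; fromℕ<)
import Data.Fin.Properties as FinP
import Data.Integer as ℤ
open import Data.Integer using (+_; ∣_∣; 0ℤ; 1ℤ)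
open import Data.Integer.DivMod using (n%ℕd<d; a≡a%ℕn+[a/ℕn]*n; _/ℕ_; _%ℕ_)
import Data.Integer.Divisibility.Signed as ℤD
import Data.Integer.Properties as ℤP
open import Data.Integer.Tactic.RingSolver using (solve-∀)
open import Data.List using (List; []; _∷_; length; filter; applyUpTo)
open import Data.List.Relation.Unary.All using (All; []; _∷_)
import Data.Nat as ℕ
open import Data.Nat using (zero; suc; _<_; NonZero; s≤s; z≤n)
open import Data.Nat.Coprimality as Coprimality using (Coprime)
import Data.Nat.DivMod as ℕDM
import Data.Nat.Divisibility as ℕD
open import Data.Nat.Divisibility using (divides)
open import Data.Nat.GCD using (module Bézout)
open import Data.Nat.ListAction using (product)
open import Data.Nat.Primality as Primality using (Prime)
open import Data.Nat.Primality.Factorisation using (PrimeFactorisation; factors; factorise)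
import Data.Nat.Properties as ℕP
open import Data.Product using (∃; _,_; proj₁; proj₂)
open import Data.Sum using (_⊎_; inj₁; inj₂)
open import Function using (it)
open import Function.Bundles using (mk⇔)
import Relation.Binary.Reasoning.Setoid as SetoidReasoning
open import Relation.Binary.PropositionalEquality as ≡ using (_≡_)
open import Relation.Nullary using (¬_; Dec; yes; no; contradiction)
open import Relation.Nullary.Decidable using (map′)
open import Relation.Unary using (Decidable)

-- Congruence of integers and residues modulo n.

infix 4 _≋_[_]

-- A record copy of _≡_[mod_], so that the two integers can be inferred.
record _≋_[_] (a b : ℤ) (n : ℕ) : Set where
  constructor cong
  field difference : a ≡ b [mod n ]
open _≋_[_] public

module _ {n : ℕ} where

  ≋-reflexive : ∀ {a b} → a ≡ b → a ≋ b [ n ]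
  ≋-reflexive {a} ≡.refl = cong (≡.subst (+ n ℤD.∣_) (≡.sym (ℤP.+-inverseʳ a)) (ℤD.divides 0ℤ ≡.refl))

  ≋-refl : ∀ {a} → a ≋ a [ n ]
  ≋-refl = ≋-reflexive ≡.refl

  ≋-sym : ∀ {a b} → a ≋ b [ n ] → b ≋ a [ n ]
  ≋-sym {a} {b} (cong d) = cong (≡.subst (+ n ℤD.∣_) (flip a b) (ℤD.∣m⇒∣-m d))
    where
    flip : ∀ x y → ℤ.- (x ℤ.- y) ≡ y ℤ.- x
    flip = solve-∀

  ≋-trans : ∀ {a b c} → a ≋ b [ n ] → b ≋ c [ n ] → a ≋ c [ n ]
  ≋-trans {a} {b} {c} (cong d) (cong e) = cong (≡.subst (+ n ℤD.∣_) (telescope a b c) (ℤD.∣m∣n⇒∣m+n d e))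
    where
    telescope : ∀ x y z → (x ℤ.- y) ℤ.+ (y ℤ.- z) ≡ x ℤ.- z
    telescope = solve-∀

  ≋-+ : ∀ {a b c d} → a ≋ b [ n ] → c ≋ d [ n ] → a ℤ.+ c ≋ b ℤ.+ d [ n ]
  ≋-+ {a} {b} {c} {d} (cong p) (cong q) = cong (≡.subst (+ n ℤD.∣_) (regroup a b c d) (ℤD.∣m∣n⇒∣m+n p q))
    where
    regroup : ∀ x y z w → (x ℤ.- y) ℤ.+ (z ℤ.- w) ≡ (x ℤ.+ z) ℤ.- (y ℤ.+ w)
    regroup = solve-∀

  ≋-neg : ∀ {a b} → a ≋ b [ n ] → ℤ.- a ≋ ℤ.- b [ n ]
  ≋-neg {a} {b} (cong p) = cong (≡.subst (+ n ℤD.∣_) (regroup a b) (ℤD.∣m⇒∣-m p))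
    where
    regroup : ∀ x y → ℤ.- (x ℤ.- y) ≡ (ℤ.- x) ℤ.- (ℤ.- y)
    regroup = solve-∀

  ≋-- : ∀ {a b c d} → a ≋ b [ n ] → c ≋ d [ n ] → a ℤ.- c ≋ b ℤ.- d [ n ]
  ≋-- p q = ≋-+ p (≋-neg q)

  ≋-* : ∀ {a b c d} → a ≋ b [ n ] → c ≋ d [ n ] → a ℤ.* c ≋ b ℤ.* d [ n ]
  ≋-* {a} {b} {c} {d} (cong p) (cong q) = cong (≡.subst (+ n ℤD.∣_) (regroup a b c d)
      (ℤD.∣m∣n⇒∣m+n (ℤD.∣m⇒∣m*n c p) (ℤD.∣n⇒∣m*n b q)))
    where
    regroup : ∀ x y z w → (x ℤ.- y) ℤ.* z ℤ.+ y ℤ.* (z ℤ.- w) ≡ x ℤ.* z ℤ.- y ℤ.* w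
    regroup = solve-∀

  ∣⇒≋0 : ∀ {a} → + n ℤD.∣ a → a ≋ 0ℤ [ n ]
  ∣⇒≋0 {a} d = cong (≡.subst (+ n ℤD.∣_) (≡.sym (ℤP.+-identityʳ a)) d)

  ≋0⇒∣ : ∀ {a} → a ≋ 0ℤ [ n ] → n ℕD.∣ ∣ a ∣
  ≋0⇒∣ {a} (cong d) = ℤD.∣⇒∣ᵤ (≡.subst (+ n ℤD.∣_) (ℤP.+-identityʳ a) d)

  ≋-*-inverse : ∀ {u v} a → u ℤ.* v ≋ 1ℤ [ n ] → (a ℤ.* u) ℤ.* v ≋ a [ n ]
  ≋-*-inverse {u} {v} a uv = ≋-trans (≋-reflexive (ℤP.*-assoc a u v))
    (≋-trans (≋-* (≋-refl {a}) uv) (≋-reflexive (ℤP.*-identityʳ a)))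

  ≋-comm-* : ∀ {u v w} → u ℤ.* v ≋ w [ n ] → v ℤ.* u ≋ w [ n ]
  ≋-comm-* {u} {v} = ≋-trans (≋-reflexive (ℤP.*-comm v u))

  ≋-cancelʳ-* : ∀ {u v a b} → u ℤ.* v ≋ 1ℤ [ n ] → a ℤ.* u ≋ b ℤ.* u [ n ] → a ≋ b [ n ]
  ≋-cancelʳ-* {u} {v} {a} {b} uv e =
    ≋-trans (≋-sym (≋-*-inverse a uv)) (≋-trans (≋-* e ≋-refl) (≋-*-inverse b uv))

≋-weaken : ∀ {d n a b} → d ℕD.∣ n → a ≋ b [ n ] → a ≋ b [ d ]
≋-weaken d∣n (cong e) = cong (ℤD.∣-trans (ℤD.∣ᵤ⇒∣ d∣n) e)

≋? : ∀ n a b → Dec (a ≋ b [ n ])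
≋? n a b = map′ cong difference (+ n ℤD.∣? (a ℤ.- b))

≋-modN : ∀ n .{{_ : NonZero n}} a → a ≋ + modN a n [ n ]
≋-modN n@(suc _) a = cong (ℤD.divides (a /ℕ n)
  (≡.trans (≡.cong (ℤ._- + (a %ℕ n)) (a≡a%ℕn+[a/ℕn]*n a n)) (lemma (+ (a %ℕ n)) _)))
  where
  lemma : ∀ x y → (x ℤ.+ y) ℤ.- x ≡ y
  lemma = solve-∀

modN<n : ∀ n .{{_ : NonZero n}} a → modN a n < n
modN<n n@(suc _) a = n%ℕd<d a n

≋-%⇒≡ : ∀ n .{{_ : NonZero n}} {i j} → + i ≋ + j [ n ] → i ℕ.% n ≡ j ℕ.% n
≋-%⇒≡ n {i} {j} (cong d) = go (≤-total i j)
  where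
  open ℕP using (≤-total)
  le : ∀ {i j} → i ≤ j → n ℕD.∣ ∣ + j ℤ.- + i ∣ → i ℕ.% n ≡ j ℕ.% n
  le {i} {j} i≤j d' with ≡.subst (n ℕD.∣_) (≡.cong ∣_∣ (≡.trans (ℤP.m-n≡m⊖n j i) (ℤP.⊖-≥ i≤j))) d'
  ... | divides q e = ≡.trans (≡.sym (ℕDM.[m+kn]%n≡m%n i q n))
          (≡.cong (ℕ._% n) (≡.trans (≡.cong (i ℕ.+_) (≡.sym e)) (ℕP.m+[n∸m]≡n i≤j)))
  go : i ≤ j ⊎ j ≤ i → i ℕ.% n ≡ j ℕ.% n
  go (inj₁ i≤j) = le i≤j (ℤD.∣⇒∣ᵤ (difference (≋-sym {n} {+ i} {+ j} (cong d))))
  go (inj₂ j≤i) = ≡.sym (le j≤i (ℤD.∣⇒∣ᵤ d))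

≋⇒≡ : ∀ {n i j} → i < n → j < n → + i ≋ + j [ n ] → i ≡ j
≋⇒≡ {n@(suc _)} i<n j<n e =
  ≡.trans (≡.sym (ℕDM.m<n⇒m%n≡m i<n)) (≡.trans (≋-%⇒≡ n e) (ℕDM.m<n⇒m%n≡m j<n))

residue : ∀ n .{{_ : NonZero n}} a → ∃ λ (i : Fin n) → + toℕ i ≋ a [ n ]
residue n a = fromℕ< (modN<n n a) , ≋-trans (≋-reflexive (≡.cong +_ (FinP.toℕ-fromℕ< (modN<n n a)))) (≋-sym (≋-modN n a))

residue-unique : ∀ {n} {i j : Fin n} → + toℕ i ≋ + toℕ j [ n ] → i ≡ j
residue-unique {n} {i} {j} e = FinP.toℕ-injective (≋⇒≡ (FinP.toℕ<n i) (FinP.toℕ<n j) e)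

-- Units modulo n.

coprime-∣ : ∀ {u d n} → d ℕD.∣ n → CoprimeTo u n → CoprimeTo u d
coprime-∣ d∣n c (e , f) = c (e , ℕD.∣-trans f d∣n)

coprime-≋ : ∀ {n u v} → u ≋ v [ n ] → CoprimeTo u n → CoprimeTo v n
coprime-≋ {n} {u} {v} uv c {d} (d∣v , d∣n) =
  c (≋0⇒∣ (≋-trans (≋-weaken d∣n uv) (∣⇒≋0 (ℤD.∣ᵤ⇒∣ d∣v))) , d∣n)

coprime-neg : ∀ {n} u → CoprimeTo u n → CoprimeTo (ℤ.- u) n
coprime-neg {n} u c = ≡.subst (λ k → Coprime k n) (≡.sym (ℤP.∣-i∣≡∣i∣ u)) c

invertible⇒coprime : ∀ {n u} v → u ℤ.* v ≋ 1ℤ [ n ] → CoprimeTo u n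
invertible⇒coprime {n} {u} v uv {d} (d∣u , d∣n) = ℕD.∣1⇒≡1 (≋0⇒∣ (≋-trans (≋-sym (≋-weaken d∣n uv))
  (≋-* {d} {u} {0ℤ} {v} {v} (∣⇒≋0 (ℤD.∣ᵤ⇒∣ d∣u)) ≋-refl)))

coprime⇒invertibleℕ : ∀ {n} i → Coprime i n → ∃ λ v → + i ℤ.* v ≋ 1ℤ [ n ]
coprime⇒invertibleℕ {n} i c with Coprimality.coprime-Bézout c
... | Bézout.+- x y e = + x , cong (ℤD.divides (+ y) (≡.trans (≡.cong (ℤ._- 1ℤ) e') (lemma (+ y ℤ.* + n))))
  where
  e' : + i ℤ.* + x ≡ 1ℤ ℤ.+ + y ℤ.* + n
  e' = ≡.trans (ℤP.*-comm (+ i) (+ x)) (≡.trans (≡.sym (ℤP.pos-* x i)) (≡.trans (≡.cong +_ (≡.sym e))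
        (≡.trans (ℤP.pos-+ 1 (y ℕ.* n)) (≡.cong (λ z → 1ℤ ℤ.+ z) (ℤP.pos-* y n)))))
  lemma : ∀ y → (1ℤ ℤ.+ y) ℤ.- 1ℤ ≡ y
  lemma = solve-∀
-- Here 1 + x i = y n, so the inverse of i is - x.
... | Bézout.-+ x y e = ℤ.- (+ x) , cong (ℤD.divides (ℤ.- (+ y)) (lemma (+ i) (+ x) (+ y) (+ n) e'))
  where
  e' : 1ℤ ℤ.+ + x ℤ.* + i ≡ + y ℤ.* + n
  e' = ≡.trans (≡.cong (λ z → 1ℤ ℤ.+ z) (≡.sym (ℤP.pos-* x i))) (≡.trans (≡.sym (ℤP.pos-+ 1 (x ℕ.* i)))
        (≡.trans (≡.cong +_ e) (ℤP.pos-* y n)))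
  regroup : ∀ i x → i ℤ.* ℤ.- x ℤ.- 1ℤ ≡ ℤ.- (1ℤ ℤ.+ x ℤ.* i)
  regroup = solve-∀
  lemma : ∀ i x y n → 1ℤ ℤ.+ x ℤ.* i ≡ y ℤ.* n → i ℤ.* ℤ.- x ℤ.- 1ℤ ≡ ℤ.- y ℤ.* n
  lemma i x y n e = ≡.trans (regroup i x) (≡.trans (≡.cong ℤ.-_ e) (ℤP.neg-distribˡ-* y n))

coprime⇒invertible : ∀ {n} u → CoprimeTo u n → ∃ λ v → u ℤ.* v ≋ 1ℤ [ n ]
coprime⇒invertible (+ i) c = coprime⇒invertibleℕ i c
coprime⇒invertible ℤ.-[1+ i ] c with coprime⇒invertibleℕ (suc i) c
... | v , e = ℤ.- v , ≋-trans (≋-reflexive (lemma (+ suc i) v)) e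
  where
  lemma : ∀ u v → ℤ.- u ℤ.* ℤ.- v ≡ u ℤ.* v
  lemma = solve-∀

coprime-* : ∀ {n u v} → CoprimeTo u n → CoprimeTo v n → CoprimeTo (u ℤ.* v) n
coprime-* {n} {u} {v} cu cv with coprime⇒invertible u cu | coprime⇒invertible v cv
... | u' , uu' | v' , vv' = invertible⇒coprime {_} {u ℤ.* v} (u' ℤ.* v')
        (≋-trans (≋-reflexive (lemma u v u' v')) (≋-* {_} {u ℤ.* u'} {1ℤ} {v ℤ.* v'} {1ℤ} uu' vv'))
  where
  lemma : ∀ u v u' v' → (u ℤ.* v) ℤ.* (u' ℤ.* v') ≡ (u ℤ.* u') ℤ.* (v ℤ.* v')
  lemma = solve-∀

-- The uniqueness half of the Chinese remainder theorem: a - b = k m for some k, and n, dividing k m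
-- and coprime to m, divides k.
≋-join : ∀ {m n a b} → Coprime m n → a ≋ b [ m ] → a ≋ b [ n ] → a ≋ b [ m ℕ.* n ]
≋-join {m} {n} {a} {b} c (cong p) (cong q) with ℤD.∣⇒∣ᵤ p
... | divides k e = cong (ℤD.∣ᵤ⇒∣ (≡.subst (m ℕ.* n ℕD.∣_) (≡.trans (ℕP.*-comm m k) (≡.sym e))
        (ℕD.*-monoʳ-∣ m (Coprimality.coprime-divisor (Coprimality.sym c)
          (≡.subst (n ℕD.∣_) (≡.trans e (ℕP.*-comm k m)) (ℤD.∣⇒∣ᵤ q))))))

-- Square-free numbers, congruence up to sign, and the two cases of ρ.

squareFree-∣ : ∀ {d n} → d ℕD.∣ n → SquareFree n → SquareFree d
squareFree-∣ d∣n sf e 2≤e e²∣d = sf e 2≤e (ℕD.∣-trans e²∣d d∣n)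

∤⇒coprime : ∀ {p n} → Prime p → ¬ p ℕD.∣ n → Coprime p n
∤⇒coprime pp p∤n {d} (d∣p , d∣n) with Primality.prime⇒irreducible pp d∣p
... | inj₁ d≡1 = d≡1
... | inj₂ ≡.refl = contradiction d∣n p∤n

prime⇒2≤ : ∀ {p} → Prime p → 2 ≤ p
prime⇒2≤ pp = ℕ.nonTrivial⇒n>1 _ {{Primality.prime⇒nonTrivial pp}}

squareFree-coprime : ∀ {p n} → Prime p → SquareFree (p ℕ.* n) → Coprime p n
squareFree-coprime {p} pp sf = ∤⇒coprime pp λ p∣n → sf p (prime⇒2≤ pp) (ℕD.*-monoʳ-∣ p p∣n)

≡±-sym : ∀ {n a b} → a ≡± b [mod n ] → b ≡± a [mod n ]
≡±-sym {n} {a} {b} (inj₁ p) = inj₁ (difference (≋-sym {n} {a} {b} (cong p)))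
≡±-sym {n} {a} {b} (inj₂ p) = inj₂ (difference (≋-trans (≋-reflexive (≡.sym (ℤP.neg-involutive b)))
  (≋-neg (≋-sym {n} {a} {ℤ.- b} (cong p)))))

≡±-trans : ∀ {n a b c} → a ≡± b [mod n ] → b ≡± c [mod n ] → a ≡± c [mod n ]
≡±-trans {n} {a} {b} {c} (inj₁ p) (inj₁ q) = inj₁ (difference (≋-trans {n} {a} {b} {c} (cong p) (cong q)))
≡±-trans {n} {a} {b} {c} (inj₁ p) (inj₂ q) = inj₂ (difference (≋-trans {n} {a} {b} {ℤ.- c} (cong p) (cong q)))
≡±-trans {n} {a} {b} {c} (inj₂ p) (inj₁ q) =
  inj₂ (difference (≋-trans {n} {a} {ℤ.- b} {ℤ.- c} (cong p) (≋-neg {n} {b} {c} (cong q))))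
≡±-trans {n} {a} {b} {c} (inj₂ p) (inj₂ q) =
  inj₁ (difference (≋-trans {n} {a} {ℤ.- b} {c} (cong p)
    (≋-trans (≋-neg {n} {b} {ℤ.- c} (cong q)) (≋-reflexive (ℤP.neg-involutive c)))))

coprime-*ʳ : ∀ {i m n} → Coprime i m → Coprime i n → Coprime i (m ℕ.* n)
coprime-*ʳ {i} {m} {n} c d = Coprimality.sym (≡.subst (λ k → Coprime k i) (ℤP.abs-* (+ m) (+ n))
  (coprime-* {i} {+ m} {+ n} (Coprimality.sym c) (Coprimality.sym d)))

prime≢1 : ∀ {p} → Prime p → ¬ p ≡ 1
prime≢1 pp ≡.refl = Primality.¬prime[1] pp

≡±-*ʳ : ∀ {n a b} x → a ≡± b [mod n ] → (a ℤ.* x) ≡± (b ℤ.* x) [mod n ]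
≡±-*ʳ {n} {a} {b} x (inj₁ p) = inj₁ (difference (≋-* {n} {a} {b} {x} {x} (cong p) ≋-refl))
≡±-*ʳ {n} {a} {b} x (inj₂ p) = inj₂ (difference (≋-trans (≋-* {n} {a} {ℤ.- b} {x} {x} (cong p) ≋-refl)
  (≋-reflexive (≡.sym (ℤP.neg-distribˡ-* b x)))))

ρ-cases : ∀ n → (2 ℕD.∣ n × ρ n ≡ 4) ⊎ (¬ 2 ℕD.∣ n × ρ n ≡ 2)
ρ-cases n with n ℕ.% 2 in eq
... | zero = inj₁ (ℕD.m%n≡0⇒n∣m n 2 eq , ≡.refl)
... | suc _ = inj₂ ((λ 2∣n → contradiction (≡.trans (≡.sym (ℕD.n∣m⇒m%n≡0 n 2 2∣n)) eq) λ ()) , ≡.refl)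

-- Indicators and finite sums in F.

module _ {c ℓ} (F : CommutativeRing c ℓ) where
  open CommutativeRing F hiding (zero)
  open RingProperties ring using (-0#≈0#; -1*x≈-x; +-identityˡ-unique)
  open SemiringSum semiring
  open SemiringSolver commutativeSemiring using (solve; _:=_; _:+_; _:*_; con)
  open SetoidReasoning setoid

  ⟦_⟧ : ∀ {p} {P : Set p} → Dec P → Carrier
  ⟦ yes _ ⟧ = 1#
  ⟦ no _ ⟧ = 0#

  ⟦⟧-yes : ∀ {p} {P : Set p} (P? : Dec P) → P → ⟦ P? ⟧ ≈ 1#
  ⟦⟧-yes (yes _) _ = refl
  ⟦⟧-yes (no ¬x) x = contradiction x ¬x

  ⟦⟧-no : ∀ {p} {P : Set p} (P? : Dec P) → ¬ P → ⟦ P? ⟧ ≈ 0#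
  ⟦⟧-no (yes x) ¬x = contradiction x ¬x
  ⟦⟧-no (no _) _ = refl

  ⟦⟧-cong : ∀ {p q} {P : Set p} {Q : Set q} (P? : Dec P) (Q? : Dec Q) → (P → Q) → (Q → P) → ⟦ P? ⟧ ≈ ⟦ Q? ⟧
  ⟦⟧-cong (yes x) Q? f g = sym (⟦⟧-yes Q? (f x))
  ⟦⟧-cong (no ¬x) Q? f g = sym (⟦⟧-no Q? λ y → ¬x (g y))

  ⟦⟧-* : ∀ {p q r} {P : Set p} {Q : Set q} {R : Set r} (P? : Dec P) (Q? : Dec Q) (R? : Dec R) →
    (P → Q → R) → (R → P × Q) → ⟦ P? ⟧ * ⟦ Q? ⟧ ≈ ⟦ R? ⟧
  ⟦⟧-* (yes x) Q? R? f g = trans (*-identityˡ _) (⟦⟧-cong Q? R? (f x) λ r → proj₂ (g r))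
  ⟦⟧-* (no ¬x) Q? R? f g = trans (zeroˡ _) (sym (⟦⟧-no R? λ r → ¬x (proj₁ (g r))))

  ⟦⟧-+ : ∀ {p q r} {P : Set p} {Q : Set q} {R : Set r} (P? : Dec P) (Q? : Dec Q) (R? : Dec R) →
    (P → ¬ Q) → (P ⊎ Q → R) → (R → P ⊎ Q) → ⟦ P? ⟧ + ⟦ Q? ⟧ ≈ ⟦ R? ⟧
  ⟦⟧-+ (yes x) Q? R? d f g = trans (+-congˡ (⟦⟧-no Q? (d x))) (trans (+-identityʳ _) (sym (⟦⟧-yes R? (f (inj₁ x)))))
  ⟦⟧-+ {P = P} {Q} {R} (no ¬x) Q? R? d f g = trans (+-identityˡ _) (⟦⟧-cong Q? R? (λ y → f (inj₂ y)) (λ r → back (g r)))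
    where
    back : P ⊎ Q → Q
    back (inj₁ x) = contradiction x ¬x
    back (inj₂ y) = y

  sum-cong : ∀ {n} {f g : Fin n → Carrier} → (∀ i → f i ≈ g i) → sum f ≈ sum g
  sum-cong = sum-cong-≋

  sum-zero : ∀ {n} {f : Fin n → Carrier} → (∀ i → f i ≈ 0#) → sum f ≈ 0#
  sum-zero {zero} z = refl
  sum-zero {suc n} z = trans (+-cong (z Fin.zero) (sum-zero λ i → z (Fin.suc i))) (+-identityˡ 0#)

  sum-single : ∀ {n} {f : Fin n → Carrier} i → (∀ j → ¬ j ≡ i → f j ≈ 0#) → sum f ≈ f i
  sum-single {suc n} {f} i z = trans (sum-remove {i = i} f)
    (trans (+-congˡ (sum-zero λ j → z (Fin.punchIn i j) (FinP.punchInᵢ≢i i j))) (+-identityʳ _))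

  -- Periodic functions and sums over the residues modulo n.

  Periodic : ℕ → (ℤ → Carrier) → Set ℓ
  Periodic n f = ∀ {a b} → a ≋ b [ n ] → f a ≈ f b

  periodic-* : ∀ {n f g} → Periodic n f → Periodic n g → Periodic n (λ a → f a * g a)
  periodic-* f g e = *-cong (f e) (g e)

  periodic-weaken : ∀ {d n f} → d ℕD.∣ n → Periodic d f → Periodic n f
  periodic-weaken d∣n f e = f (≋-weaken d∣n e)

  δ : ℕ → ℤ → ℤ → Carrier
  δ n a b = ⟦ ≋? n a b ⟧

  δ-cong : ∀ {n a b c d} → a ≋ c [ n ] → b ≋ d [ n ] → δ n a b ≈ δ n c d
  δ-cong p q = ⟦⟧-cong (≋? _ _ _) (≋? _ _ _)
    (λ e → ≋-trans (≋-sym p) (≋-trans e q)) (λ e → ≋-trans p (≋-trans e (≋-sym q)))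

  -- Opaque so that f can be inferred from ∑mod n f.
  opaque

    ∑mod : ℕ → (ℤ → Carrier) → Carrier
    ∑mod n f = sum {n} (λ i → f (+ toℕ i))

    ∑mod-cong : ∀ n {f g} → (∀ a → f a ≈ g a) → ∑mod n f ≈ ∑mod n g
    ∑mod-cong n e = sum-cong {n} λ i → e (+ toℕ i)

    ∑mod-+ : ∀ n f g → ∑mod n (λ a → f a + g a) ≈ ∑mod n f + ∑mod n g
    ∑mod-+ n f g = ∑-distrib-+ {n} _ _

    ∑mod-*ˡ : ∀ n x f → x * ∑mod n f ≈ ∑mod n (λ a → x * f a)
    ∑mod-*ˡ n x f = *-distribˡ-sum {n} x _

    ∑mod-*ʳ : ∀ n x f → ∑mod n f * x ≈ ∑mod n (λ a → f a * x)
    ∑mod-*ʳ n x f = *-distribʳ-sum {n} x _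

    ∑mod-swap : ∀ n m (f : ℤ → ℤ → Carrier) → ∑mod n (λ a → ∑mod m (f a)) ≈ ∑mod m (λ b → ∑mod n (λ a → f a b))
    ∑mod-swap n m f = ∑-comm {n} {m} _

    ∑mod-∑-swap : ∀ n {m} (f : Fin m → ℤ → Carrier) → sum (λ k → ∑mod n (f k)) ≈ ∑mod n (λ a → sum λ k → f k a)
    ∑mod-∑-swap n {m} f = ∑-comm {m} {n} _

    ∑mod-1 : ∀ n → ∑mod n (λ _ → 1#) ≈ fromℕ F n
    ∑mod-1 zero = refl
    ∑mod-1 (suc n) = +-congˡ (∑mod-1 n)

    -- The index 0 is always counted, so the count is positive; `fromℕ F (suc k)` is the form that
    -- `CharZero` keeps apart from 0.
    ∑mod-count : ∀ n .{{_ : NonZero n}} {p} {P : ℤ → Set p} (P? : ∀ a → Dec (P a)) → P 0ℤ →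
      ∃ λ k → ∑mod n (λ a → ⟦ P? a ⟧) ≈ fromℕ F (suc k)
    ∑mod-count (suc n) P? P0 with count {n} (λ i → P? (+ suc (toℕ i)))
      where
      count : ∀ {n p} {P : Fin n → Set p} (P? : ∀ i → Dec (P i)) → ∃ λ k → sum (λ i → ⟦ P? i ⟧) ≈ fromℕ F k
      count {zero} P? = 0 , refl
      count {suc n} P? with P? Fin.zero | count (λ i → P? (Fin.suc i))
      ... | yes _ | k , e = suc k , +-congˡ e
      ... | no _ | k , e = k , trans (+-identityˡ _) e
    ... | k , e = k , +-cong (⟦⟧-yes (P? 0ℤ) P0) e

    -- Exactly one index among 0, ..., n - 1 is congruent to `b`; periodicity carries the value of
    -- `f` from there to `b`, which may be any integer.
    ∑mod-δ : ∀ {n} {{_ : NonZero n}} {f} → Periodic n f → ∀ b → ∑mod n (λ a → δ n a b * f a) ≈ f b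
    ∑mod-δ {n} {f} per b with residue n b
    ... | i , e = trans
            (sum-single i λ j j≢i → trans
              (*-congʳ (⟦⟧-no (≋? n _ _) λ e' → j≢i (residue-unique (≋-trans e' (≋-sym e)))))
              (zeroˡ _))
            (trans (*-cong (⟦⟧-yes (≋? n _ _) e) (per e)) (*-identityˡ _))

  module _ {n : ℕ} {{_ : NonZero n}} where

    -- Expand f(φ a) as a sum over b of [b ≡ φ a] f(b), swap the sums, and use that b ≡ φ a if and
    -- only if a ≡ ψ b. The bijection is thus given by maps of integers that respect congruence, not
    -- by a permutation of `Fin n`.
    ∑mod-reindex : ∀ {f} → Periodic n f → (φ ψ : ℤ → ℤ) →
      (∀ {a b} → a ≋ b [ n ] → φ a ≋ φ b [ n ]) → (∀ {a b} → a ≋ b [ n ] → ψ a ≋ ψ b [ n ]) →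
      (∀ a → ψ (φ a) ≋ a [ n ]) → (∀ a → φ (ψ a) ≋ a [ n ]) → ∑mod n (λ a → f (φ a)) ≈ ∑mod n f
    ∑mod-reindex {f} per φ ψ φ-cong ψ-cong ψφ φψ = begin
      ∑mod n (λ a → f (φ a))
        ≈⟨ ∑mod-cong n (λ a → sym (∑mod-δ per (φ a))) ⟩
      ∑mod n (λ a → ∑mod n λ b → δ n b (φ a) * f b)
        ≈⟨ ∑mod-swap n n (λ a b → δ n b (φ a) * f b) ⟩
      ∑mod n (λ b → ∑mod n λ a → δ n b (φ a) * f b)
        ≈⟨ ∑mod-cong n (λ b → trans (∑mod-cong n λ a → *-congʳ (transpose a b)) (∑mod-δ {f = λ _ → f b} (λ _ → refl) (ψ b))) ⟩
      ∑mod n f ∎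
      where
      transpose : ∀ a b → δ n b (φ a) ≈ δ n a (ψ b)
      transpose a b = ⟦⟧-cong (≋? n _ _) (≋? n _ _)
        (λ e → ≋-trans (≋-sym (ψφ a)) (≋-sym (ψ-cong e)))
        (λ e → ≋-trans (≋-sym (φψ b)) (≋-sym (φ-cong e)))

    ∑mod-shift : ∀ {f} → Periodic n f → ∀ h → ∑mod n (λ a → f (a ℤ.+ h)) ≈ ∑mod n f
    ∑mod-shift per h = ∑mod-reindex per (ℤ._+ h) (ℤ._- h) (λ e → ≋-+ e ≋-refl) (λ e → ≋-+ e ≋-refl)
      (λ a → ≋-reflexive (l₁ a h)) (λ a → ≋-reflexive (l₂ a h))
      where
      l₁ : ∀ a h → (a ℤ.+ h) ℤ.- h ≡ a
      l₁ = solve-∀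
      l₂ : ∀ a h → (a ℤ.- h) ℤ.+ h ≡ a
      l₂ = solve-∀

    ∑mod-scale : ∀ {f} u v → Periodic n f → u ℤ.* v ≋ 1ℤ [ n ] → ∑mod n (λ a → f (a ℤ.* u)) ≈ ∑mod n f
    ∑mod-scale u v per uv = ∑mod-reindex per (ℤ._* u) (ℤ._* v) (λ e → ≋-* e ≋-refl) (λ e → ≋-* e ≋-refl)
      (λ a → ≋-*-inverse a uv) (λ a → ≋-*-inverse a (≋-comm-* {u = u} uv))

  -- Sums over units and over representatives.

  w : ℕ → ℤ → Carrier
  w n a = ⟦ Coprimality.coprime? ∣ a ∣ n ⟧

  w-periodic : ∀ n → Periodic n (w n)
  w-periodic n {a} {b} e = ⟦⟧-cong (Coprimality.coprime? ∣ a ∣ n) (Coprimality.coprime? ∣ b ∣ n)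
    (coprime-≋ {n} {a} {b} e) (coprime-≋ {n} {b} {a} (≋-sym e))

  w-scale : ∀ {n} u v → u ℤ.* v ≋ 1ℤ [ n ] → ∀ a → w n (a ℤ.* u) ≈ w n a
  w-scale {n} u v uv a = ⟦⟧-cong (Coprimality.coprime? ∣ a ℤ.* u ∣ n) (Coprimality.coprime? ∣ a ∣ n)
    (λ c → coprime-≋ {n} {a ℤ.* u ℤ.* v} {a} (≋-*-inverse a uv) (coprime-* {n} {a ℤ.* u} {v} c (invertible⇒coprime {n} {v} u (≋-comm-* {u = u} uv))))
    (λ c → coprime-* {n} {a} {u} c (invertible⇒coprime {n} {u} v uv))

  ∑units : ℕ → (ℤ → Carrier) → Carrier
  ∑units n f = ∑mod n (λ a → w n a * f a)

  ∑units-cong : ∀ n {f g} → (∀ a → CoprimeTo a n → f a ≈ g a) → ∑units n f ≈ ∑units n g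
  ∑units-cong n {f} {g} e = ∑mod-cong n λ a → go a (Coprimality.coprime? ∣ a ∣ n)
    where
    go : ∀ a (d : Dec (CoprimeTo a n)) → ⟦ d ⟧ * f a ≈ ⟦ d ⟧ * g a
    go a (yes c) = *-congˡ (e a c)
    go a (no _) = trans (zeroˡ _) (sym (zeroˡ _))

  ∑units-scale : ∀ {n} {{_ : NonZero n}} {f} u v → Periodic n f → u ℤ.* v ≋ 1ℤ [ n ] →
    ∑units n (λ a → f (a ℤ.* u)) ≈ ∑units n f
  ∑units-scale {n} {f} u v per uv = trans
    (∑mod-cong n λ a → *-congʳ (sym (w-scale u v uv a)))
    (∑mod-scale u v (periodic-* {f = w n} {f} (w-periodic n) per) uv)

  -- The two indicators exclude each other: v ≡ u and v ≡ - u give 2 v ≡ 0, hence 2 ≡ 0 (mod n) for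
  -- the unit v, against n ≥ 3. The decision `R?` is left free so that it can also be an equality of
  -- indices.
  δ-± : ∀ n {u v r} {R : Set r} (R? : Dec R) → CoprimeTo v n → 3 ≤ n →
    (u ≡± v [mod n ] → R) → (R → u ≡± v [mod n ]) → δ n v u + δ n v (ℤ.- u) ≈ ⟦ R? ⟧
  δ-± n {u} {v} R? cv 3≤n f g =
    ⟦⟧-+ (≋? n v u) (≋? n v (ℤ.- u)) R? exclusive (λ h → f (unsplit h)) (λ h → split (g h))
    where
    unsplit : v ≋ u [ n ] ⊎ v ≋ ℤ.- u [ n ] → u ≡± v [mod n ]
    unsplit (inj₁ e) = inj₁ (difference (≋-sym e))
    unsplit (inj₂ e) = inj₂ (difference (≋-trans (≋-reflexive (≡.sym (ℤP.neg-involutive u))) (≋-neg (≋-sym e))))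
    split : u ≡± v [mod n ] → v ≋ u [ n ] ⊎ v ≋ ℤ.- u [ n ]
    split (inj₁ e) = inj₁ (≋-sym (cong e))
    split (inj₂ e) = inj₂ (≋-trans (≋-reflexive (≡.sym (ℤP.neg-involutive v))) (≋-neg {_} {ℤ.- v} {u} (≋-sym (cong {u} {ℤ.- v} e))))
    exclusive : v ≋ u [ n ] → ¬ v ≋ ℤ.- u [ n ]
    exclusive e e' = ℕP.<-irrefl ≡.refl (ℕP.<-≤-trans 3≤n (ℕD.∣⇒≤ (≋0⇒∣ two)))
      where
      2v : v ℤ.+ v ≋ 0ℤ [ n ]
      2v = ≋-trans (≋-+ e e') (≋-reflexive (ℤP.+-inverseʳ u))
      v' = proj₁ (coprime⇒invertible v cv)
      two : + 2 ≋ 0ℤ [ n ]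
      two = ≋-trans (≋-sym (≋-* {_} {+ 2} {+ 2} {v ℤ.* v'} {1ℤ} ≋-refl (proj₂ (coprime⇒invertible v cv))))
              (≋-trans (≋-reflexive (lemma v v')) (≋-* {_} {v ℤ.+ v} {0ℤ} {v'} {v'} 2v ≋-refl))
        where
        lemma : ∀ v v' → (+ 2) ℤ.* (v ℤ.* v') ≡ (v ℤ.+ v) ℤ.* v'
        lemma = solve-∀

  -- Each unit is congruent to exactly one of the integers `r k` and `- r k`, and a non-unit to none
  -- of them, so counting these hits for a given a yields the indicator `w n a`.
  ∑units-reps : ∀ {n} {{_ : NonZero n}} → 3 ≤ n → ∀ {m r} → IsRepSystem n m r →
    ∀ {f} → Periodic n f → sum {m} (λ k → f (r k) + f (ℤ.- r k)) ≈ ∑units n f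
  ∑units-reps {n} 3≤n {m} {r} (unit , distinct , covers) {f} per = begin
    sum (λ k → f (r k) + f (ℤ.- r k))
      ≈⟨ sum-cong (λ k → sym (trans (∑mod-cong n (λ a → distribʳ (f a) _ _)) (trans (∑mod-+ n _ _)
           (+-cong (∑mod-δ per (r k)) (∑mod-δ per (ℤ.- r k)))))) ⟩
    sum (λ k → ∑mod n λ a → hits a k * f a)
      ≈⟨ ∑mod-∑-swap n (λ k a → hits a k * f a) ⟩
    ∑mod n (λ a → sum λ k → hits a k * f a)
      ≈⟨ ∑mod-cong n (λ a → trans (sym (*-distribʳ-sum (f a) (hits a))) (*-congʳ (count a))) ⟩
    ∑units n f ∎
    where
    hits : ℤ → Fin m → Carrier
    hits a k = δ n a (r k) + δ n a (ℤ.- r k)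
    count : ∀ a → sum (hits a) ≈ w n a
    count a with Coprimality.coprime? ∣ a ∣ n
    ... | yes ca = trans (sum-single i λ j j≢i →
                     (δ-± n {r j} (no λ e → j≢i (distinct j i (≡±-trans {n} {r j} {a} {r i} e (≡±-sym {n} {r i} {a} a≡)))) ca 3≤n (λ e → e) (λ e → e)))
                   (δ-± n (yes a≡) ca 3≤n (λ _ → a≡) (λ _ → a≡))
      where
      i = proj₁ (covers a ca)
      a≡ = proj₂ (covers a ca)
    ... | no ¬ca = sum-zero λ k → trans (+-cong
                     (⟦⟧-no (≋? n a (r k)) λ e → ¬ca (coprime-≋ {n} {r k} {a} (≋-sym e) (unit k)))
                     (⟦⟧-no (≋? n a (ℤ.- r k)) λ e → ¬ca (coprime-≋ {n} {ℤ.- r k} {a} (≋-sym e) (coprime-neg {n} (r k) (unit k)))))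
                     (+-identityˡ 0#)

  -- The divisor count and its product over the primes.

  -- The bound `N` on the divisors q is separate from `n`, so that it stays fixed while the
  -- induction over the prime factors shrinks `n`.
  μ : ℕ → ℕ → ℤ → Carrier
  μ N n a = sum {N} (λ q → ⟦ toℕ q ℕD.∣? n ⟧ * δ (toℕ q) a 1ℤ)

  μ-periodic : ∀ N n → Periodic n (μ N n)
  μ-periodic N n {a} {b} a≋b = sum-cong {N} λ q → go (toℕ q) (toℕ q ℕD.∣? n)
    where
    go : ∀ q (q∣n? : Dec (q ℕD.∣ n)) → ⟦ q∣n? ⟧ * δ q a 1ℤ ≈ ⟦ q∣n? ⟧ * δ q b 1ℤ
    go q (yes q∣n) = *-congˡ (δ-cong (≋-weaken q∣n a≋b) ≋-refl)
    go q (no _) = trans (zeroˡ _) (sym (zeroˡ _))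

  ν₁ : ℕ → ℤ → Carrier
  ν₁ p a = δ p a 1ℤ - δ p a 0ℤ

  ν : List ℕ → ℤ → Carrier
  ν [] a = 1#
  ν (p ∷ ps) a = ν₁ p a * ν ps a

  χ : List ℕ → ℤ → Carrier
  χ [] a = 1#
  χ (p ∷ ps) a = (1# + ν₁ p a) * χ ps a

  ν₁-periodic : ∀ p → Periodic p (ν₁ p)
  ν₁-periodic p e = +-cong (δ-cong e ≋-refl) (-‿cong (δ-cong e ≋-refl))

  ν-periodic : ∀ ps → Periodic (product ps) (ν ps)
  ν-periodic [] e = refl
  ν-periodic (p ∷ ps) e = *-cong (ν₁-periodic p (≋-weaken (ℕD.m∣m*n _) e)) (ν-periodic ps (≋-weaken (ℕD.n∣m*n p) e))

  χ-periodic : ∀ ps → Periodic (product ps) (χ ps)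
  χ-periodic [] e = refl
  χ-periodic (p ∷ ps) e = *-cong (+-congˡ (ν₁-periodic p (≋-weaken (ℕD.m∣m*n _) e))) (χ-periodic ps (≋-weaken (ℕD.n∣m*n p) e))

  x-0≈x : ∀ x → x - 0# ≈ x
  x-0≈x x = trans (+-congˡ -0#≈0#) (+-identityʳ x)

  δ-1 : ∀ a b → δ 1 a b ≈ 1#
  δ-1 a b = ⟦⟧-yes (≋? 1 a b) (cong (ℤD.∣ᵤ⇒∣ (ℕD.1∣ _)))

  module _ {p n : ℕ} (p-prime : Prime p) (coprime : Coprime p n) where
    private
      instance
        p≢0 : NonZero p
        p≢0 = Primality.prime⇒nonZero p-prime

    -- The divisors of p n not divisible by p are the divisors of n; the others are the p d with d ∣
    -- n, and none of these divides n. In the inner sum only d = q / p can contribute.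
    ∣p*n⇔ : ∀ N (q : Fin N) → ⟦ toℕ q ℕD.∣? p ℕ.* n ⟧ ≈
      ⟦ toℕ q ℕD.∣? n ⟧ + sum {N} (λ d → ⟦ toℕ d ℕD.∣? n ⟧ * ⟦ toℕ q ℕ.≟ p ℕ.* toℕ d ⟧)
    ∣p*n⇔ N q with p ℕD.∣? toℕ q
    ... | no p∤q = sym (trans
            (+-cong (⟦⟧-cong (toℕ q ℕD.∣? n) (toℕ q ℕD.∣? p ℕ.* n) (ℕD.∣n⇒∣m*n p)
                (Coprimality.coprime-divisor (Coprimality.sym (∤⇒coprime p-prime p∤q))))
              (sum-zero {N} λ d → trans (*-congˡ (⟦⟧-no (toℕ q ℕ.≟ p ℕ.* toℕ d)
                λ q≡pd → p∤q (≡.subst (p ℕD.∣_) (≡.sym q≡pd) (ℕD.m∣m*n (toℕ d))))) (zeroʳ _)))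
            (+-identityʳ _))
    ... | yes (divides k q≡kp) = sym (trans
            (+-cong (⟦⟧-no (toℕ q ℕD.∣? n) λ q∣n → prime≢1 p-prime (coprime (ℕD.∣-refl , ℕD.∣-trans (divides k q≡kp) q∣n)))
              (sum-single {N} κ λ d d≢κ → trans (*-congˡ (⟦⟧-no (toℕ q ℕ.≟ p ℕ.* toℕ d)
                λ q≡pd → d≢κ (FinP.toℕ-injective (≡.trans (ℕP.*-cancelˡ-≡ _ _ p (≡.trans (≡.sym q≡pd) q≡pk)) (≡.sym κ≡k))))) (zeroʳ _)))
            (trans (+-identityˡ _)
              (⟦⟧-* (toℕ κ ℕD.∣? n) (toℕ q ℕ.≟ p ℕ.* toℕ κ) (toℕ q ℕD.∣? p ℕ.* n)
                (λ κ∣n q≡pκ → ≡.subst (ℕD._∣ p ℕ.* n) (≡.sym q≡pκ) (ℕD.*-monoʳ-∣ p κ∣n))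
                (λ q∣pn → ℕD.*-cancelˡ-∣ p (≡.subst (ℕD._∣ p ℕ.* n) q≡pκ' q∣pn) , q≡pκ'))))
      where
      q≡pk : toℕ q ≡ p ℕ.* k
      q≡pk = ≡.trans q≡kp (ℕP.*-comm k p)
      k<N : k < N
      k<N = ℕP.≤-<-trans (≡.subst (k ≤_) (≡.sym q≡kp) (ℕP.m≤m*n k p)) (FinP.toℕ<n q)
      κ = fromℕ< k<N
      κ≡k : toℕ κ ≡ k
      κ≡k = FinP.toℕ-fromℕ< k<N
      q≡pκ' : toℕ q ≡ p ℕ.* toℕ κ
      q≡pκ' = ≡.trans q≡pk (≡.cong (p ℕ.*_) (≡.sym κ≡k))

    -- The new divisors p d contribute [a ≡ 1 (p d)] = [a ≡ 1 (p)] [a ≡ 1 (d)], as p and d are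
    -- coprime. The bound p n < N keeps every p d within the range of summation.
    μ-* : ∀ N .{{_ : NonZero n}} → p ℕ.* n < N → ∀ a → μ N (p ℕ.* n) a ≈ (1# + δ p a 1ℤ) * μ N n a
    μ-* N pn<N a = begin
      μ N (p ℕ.* n) a
        ≈⟨ sum-cong {N} (λ q → trans (*-congʳ (∣p*n⇔ N q)) (trans (distribʳ _ _ _) (+-congˡ (*-distribʳ-sum {N} (D q) _)))) ⟩
      sum {N} (λ q → ⟦ toℕ q ℕD.∣? n ⟧ * D q + sum {N} λ d → ⟦ toℕ d ℕD.∣? n ⟧ * ⟦ toℕ q ℕ.≟ p ℕ.* toℕ d ⟧ * D q)
        ≈⟨ ∑-distrib-+ {N} _ _ ⟩
      μ N n a + sum {N} (λ q → sum {N} λ d → ⟦ toℕ d ℕD.∣? n ⟧ * ⟦ toℕ q ℕ.≟ p ℕ.* toℕ d ⟧ * D q)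
        ≈⟨ +-congˡ (∑-comm {N} {N} λ q d → ⟦ toℕ d ℕD.∣? n ⟧ * ⟦ toℕ q ℕ.≟ p ℕ.* toℕ d ⟧ * D q) ⟩
      μ N n a + sum {N} (λ d → sum {N} λ q → ⟦ toℕ d ℕD.∣? n ⟧ * ⟦ toℕ q ℕ.≟ p ℕ.* toℕ d ⟧ * D q)
        ≈⟨ +-congˡ (sum-cong {N} λ d → collapse d (toℕ d ℕD.∣? n)) ⟩
      μ N n a + sum {N} (λ d → δ p a 1ℤ * (⟦ toℕ d ℕD.∣? n ⟧ * D d))
        ≈⟨ +-cong (sym (*-identityˡ _)) (sym (*-distribˡ-sum {N} (δ p a 1ℤ) (λ d → ⟦ toℕ d ℕD.∣? n ⟧ * D d))) ⟩
      1# * μ N n a + δ p a 1ℤ * μ N n a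
        ≈⟨ distribʳ _ _ _ ⟨
      (1# + δ p a 1ℤ) * μ N n a ∎
      where
      D : Fin N → Carrier
      D q = δ (toℕ q) a 1ℤ
      collapse : ∀ d (d∣n? : Dec (toℕ d ℕD.∣ n)) → sum {N} (λ q → ⟦ d∣n? ⟧ * ⟦ toℕ q ℕ.≟ p ℕ.* toℕ d ⟧ * D q) ≈
        δ p a 1ℤ * (⟦ d∣n? ⟧ * D d)
      collapse d (no _) = trans (sum-zero {N} λ q → trans (*-congʳ (zeroˡ _)) (zeroˡ _))
        (sym (trans (*-congˡ (zeroˡ _)) (zeroʳ _)))
      collapse d (yes d∣n) = trans
        (sum-single {N} pd λ q q≢pd → trans
          (*-congʳ (trans (*-congˡ (⟦⟧-no (toℕ q ℕ.≟ p ℕ.* toℕ d)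
            λ q≡ → q≢pd (FinP.toℕ-injective (≡.trans q≡ (≡.sym pd≡))))) (zeroʳ _)))
          (zeroˡ _))
        (trans (*-congʳ (trans (*-identityˡ _) (⟦⟧-yes (toℕ pd ℕ.≟ p ℕ.* toℕ d) pd≡)))
        (trans (*-identityˡ _)
        (trans (sym (⟦⟧-* (≋? p a 1ℤ) (≋? (toℕ d) a 1ℤ) (≋? (toℕ pd) a 1ℤ)
          (λ x y → ≡.subst (λ m → a ≋ 1ℤ [ m ]) (≡.sym pd≡)
            (≋-join (λ { (e∣p , e∣d) → coprime (e∣p , ℕD.∣-trans e∣d d∣n) }) x y))
          (λ x → let y = ≡.subst (λ m → a ≋ 1ℤ [ m ]) pd≡ x in
            ≋-weaken (ℕD.m∣m*n (toℕ d)) y , ≋-weaken (ℕD.n∣m*n p) y)))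
        (*-congˡ (sym (*-identityˡ _))))))
        where
        pd<N : p ℕ.* toℕ d < N
        pd<N = ℕP.≤-<-trans (ℕP.*-monoʳ-≤ p (ℕD.∣⇒≤ d∣n)) pn<N
        pd = fromℕ< pd<N
        pd≡ : toℕ pd ≡ p ℕ.* toℕ d
        pd≡ = FinP.toℕ-fromℕ< pd<N

    -- If a ≡ 0 (mod p), then a is no unit modulo p n and 1 + ν_p(a) = 0. Otherwise [a ≡ 0 (p)] = 0,
    -- and a is a unit modulo p n exactly when it is one modulo n.
    w-* : ∀ a → w (p ℕ.* n) a * (1# + δ p a 1ℤ) ≈ (1# + ν₁ p a) * w n a
    w-* a with ≋? p a 0ℤ
    ... | yes a≋0 = begin
      w (p ℕ.* n) a * (1# + δ p a 1ℤ)
        ≈⟨ *-congʳ (⟦⟧-no (Coprimality.coprime? ∣ a ∣ (p ℕ.* n)) λ c → prime≢1 p-prime (c (≋0⇒∣ a≋0 , ℕD.m∣m*n n))) ⟩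
      0# * (1# + δ p a 1ℤ)
        ≈⟨ trans (zeroˡ _) (sym (zeroˡ _)) ⟩
      0# * w n a
        ≈⟨ *-congʳ (trans (+-congˡ (trans (+-congʳ (⟦⟧-no (≋? p a 1ℤ) λ a≋1 → 1≢0 (≋-trans (≋-sym a≋1) a≋0))) (+-identityˡ _))) (-‿inverseʳ 1#)) ⟨
      (1# + (δ p a 1ℤ - 1#)) * w n a ∎
      where
      1≢0 : ¬ 1ℤ ≋ 0ℤ [ p ]
      1≢0 h = prime≢1 p-prime (ℕD.∣1⇒≡1 (≋0⇒∣ h))
    ... | no a≉0 = trans (*-comm _ _) (*-cong (+-congˡ (sym (x-0≈x _)))
            (⟦⟧-cong (Coprimality.coprime? ∣ a ∣ (p ℕ.* n)) (Coprimality.coprime? ∣ a ∣ n)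
              (coprime-∣ {a} (ℕD.n∣m*n p)) (coprime-*ʳ a⊥p)))
      where
      a⊥p : CoprimeTo a p
      a⊥p = Coprimality.sym (∤⇒coprime p-prime λ p∣a → a≉0 (∣⇒≋0 (ℤD.∣ᵤ⇒∣ p∣a)))

  -- Induction on the prime factors: `μ-*` and `w-*` together split off one factor 1 + ν_p, where
  -- square-freeness makes p coprime to the remaining product.
  w*μ≈χ : ∀ ps N → All Prime ps → SquareFree (product ps) → product ps < N → ∀ a →
    w (product ps) a * μ N (product ps) a ≈ χ ps a
  w*μ≈χ [] (suc zero) _ _ (s≤s ()) a
  w*μ≈χ [] N@(suc (suc _)) _ _ _ a = trans
    (*-cong (⟦⟧-yes (Coprimality.coprime? ∣ a ∣ 1) (Coprimality.sym (Coprimality.1-coprimeTo ∣ a ∣)))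
      (trans (sum-single {N} {λ q → ⟦ toℕ q ℕD.∣? 1 ⟧ * δ (toℕ q) a 1ℤ} (Fin.suc Fin.zero) λ q q≢1 → trans (*-congʳ (⟦⟧-no (toℕ q ℕD.∣? 1)
          λ q∣1 → q≢1 (FinP.toℕ-injective (ℕD.∣1⇒≡1 q∣1)))) (zeroˡ _))
        (trans (*-cong (⟦⟧-yes (1 ℕD.∣? 1) ℕD.∣-refl) (δ-1 a 1ℤ)) (*-identityˡ 1#))))
    (*-identityˡ 1#)
  w*μ≈χ (p ∷ ps) N (p-prime ∷ primes) sf pn<N a = begin
    w (p ℕ.* n) a * μ N (p ℕ.* n) a
      ≈⟨ trans (*-congˡ (μ-* p-prime coprime N pn<N a)) (sym (*-assoc _ _ _)) ⟩
    w (p ℕ.* n) a * (1# + δ p a 1ℤ) * μ N n a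
      ≈⟨ trans (*-congʳ (w-* p-prime coprime a)) (*-assoc _ _ _) ⟩
    (1# + ν₁ p a) * (w n a * μ N n a)
      ≈⟨ *-congˡ (w*μ≈χ ps N primes (squareFree-∣ (ℕD.n∣m*n p) sf) (ℕP.≤-<-trans (ℕP.m≤n*m n p) pn<N) a) ⟩
    (1# + ν₁ p a) * χ ps a ∎
    where
    n = product ps
    instance
      n≢0 : NonZero n
      n≢0 = Primality.productOfPrimes≢0 primes
      p≢0 : NonZero p
      p≢0 = Primality.prime⇒nonZero p-prime
    coprime : Coprime p n
    coprime = squareFree-coprime p-prime sf

  -- At a unit all terms [a ≡ 0 (p)] vanish, and the remaining [a ≡ 1 (p)] multiply to [a ≡ 1 (n)]
  -- by coprimality.
  ν-unit : ∀ ps → All Prime ps → SquareFree (product ps) → ∀ {a} → CoprimeTo a (product ps) →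
    ν ps a ≈ δ (product ps) a 1ℤ
  ν-unit [] _ _ {a} _ = sym (δ-1 a 1ℤ)
  ν-unit (p ∷ ps) (p-prime ∷ primes) sf {a} c = trans
    (*-cong
      (trans (+-congˡ (-‿cong (⟦⟧-no (≋? p a 0ℤ) λ a≋0 → prime≢1 p-prime (c (≋0⇒∣ a≋0 , ℕD.m∣m*n (product ps)))))) (x-0≈x _))
      (ν-unit ps primes (squareFree-∣ (ℕD.n∣m*n p) sf) {a} (coprime-∣ {a} (ℕD.n∣m*n p) c)))
    (⟦⟧-* (≋? p a 1ℤ) (≋? (product ps) a 1ℤ) (≋? (p ℕ.* product ps) a 1ℤ)
      (≋-join (squareFree-coprime p-prime sf))
      (λ e → ≋-weaken (ℕD.m∣m*n (product ps)) e , ≋-weaken (ℕD.n∣m*n p) e))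

  -- The additive character e(a) = ζ^a modulo n and its sums.

  module Cosines (isField : IsField F) (n : ℕ) {{_ : NonZero n}} (3≤n : 3 ≤ n)
      (ζ : Carrier) (root : IsPrimitiveRoot F n ζ) where

    ^-+ : ∀ i j → pow F ζ (i ℕ.+ j) ≈ pow F ζ i * pow F ζ j
    ^-+ zero j = sym (*-identityˡ _)
    ^-+ (suc i) j = trans (*-congˡ (^-+ i j)) (sym (*-assoc _ _ _))

    ^-multiple : ∀ k → pow F ζ (k ℕ.* n) ≈ 1#
    ^-multiple zero = refl
    ^-multiple (suc k) = trans (^-+ n (k ℕ.* n)) (trans (*-cong (proj₁ root) (^-multiple k)) (*-identityˡ 1#))

    ^-% : ∀ i → pow F ζ i ≈ pow F ζ (i ℕ.% n)
    ^-% i = trans (reflexive (≡.cong (pow F ζ) (ℕDM.m≡m%n+[m/n]*n i n)))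
      (trans (^-+ (i ℕ.% n) _) (trans (*-congˡ (^-multiple (i ℕ./ n))) (*-identityʳ _)))

    ^-≋ : ∀ {i j} → + i ≋ + j [ n ] → pow F ζ i ≈ pow F ζ j
    ^-≋ {i} {j} e = trans (^-% i) (trans (reflexive (≡.cong (pow F ζ) (≋-%⇒≡ n e))) (sym (^-% j)))

    e : ℤ → Carrier
    e a = pow F ζ (modN a n)

    e-periodic : Periodic n e
    e-periodic {a} {b} a≋b = ^-≋ (≋-trans (≋-sym (≋-modN n a)) (≋-trans a≋b (≋-modN n b)))

    e-+ : ∀ a b → e (a ℤ.+ b) ≈ e a * e b
    e-+ a b = trans (^-≋ (≋-trans (≋-sym (≋-modN n (a ℤ.+ b)))
        (≋-trans (≋-+ (≋-modN n a) (≋-modN n b)) (≋-reflexive (≡.sym (ℤP.pos-+ (modN a n) (modN b n)))))))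
      (^-+ (modN a n) (modN b n))

    e≈1⇒≋0 : ∀ a → e a ≈ 1# → a ≋ 0ℤ [ n ]
    e≈1⇒≋0 a ea≈1 = ≋-trans (≋-modN n a) (≋-reflexive (≡.cong +_ (go (modN a n) (modN<n n a) ea≈1)))
      where
      go : ∀ i → i < n → pow F ζ i ≈ 1# → i ≡ 0
      go zero _ _ = ≡.refl
      go (suc i) i<n p = contradiction p (proj₂ root (suc i) (s≤s z≤n) i<n)

    e-≋0 : ∀ {a} → a ≋ 0ℤ [ n ] → e a ≈ 1#
    e-≋0 {a} a≋0 = ^-≋ {modN a n} {0} (≋-trans (≋-sym (≋-modN n a)) a≋0)

    -- (κ - 1) x = 0, and κ - 1 has an inverse in the field.
    fixed⇒zero : ∀ {κ x} → ¬ κ ≈ 1# → κ * x ≈ x → x ≈ 0#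
    fixed⇒zero {κ} {x} κ≉1 κx≈x with proj₂ isField (κ - 1#) (λ d → κ≉1 (-≈0⇒≈ d))
      where
      -≈0⇒≈ : ∀ {y z} → y - z ≈ 0# → y ≈ z
      -≈0⇒≈ {y} {z} d = begin
        y ≈⟨ +-identityʳ y ⟨
        y + 0# ≈⟨ +-congˡ (-‿inverseˡ z) ⟨
        y + (- z + z) ≈⟨ +-assoc _ _ _ ⟨
        (y - z) + z ≈⟨ +-congʳ d ⟩
        0# + z ≈⟨ +-identityˡ z ⟩
        z ∎
    ... | v , [κ-1]v≈1 = begin
      x ≈⟨ *-identityˡ x ⟨
      1# * x ≈⟨ *-congʳ [κ-1]v≈1 ⟨
      (κ - 1#) * v * x ≈⟨ trans (*-congʳ (*-comm _ _)) (*-assoc _ _ _) ⟩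
      v * ((κ - 1#) * x) ≈⟨ *-congˡ (distribʳ x κ (- 1#)) ⟩
      v * (κ * x + - 1# * x) ≈⟨ *-congˡ (+-cong κx≈x (-1*x≈-x x)) ⟩
      v * (x - x) ≈⟨ *-congˡ (-‿inverseʳ x) ⟩
      v * 0# ≈⟨ zeroʳ v ⟩
      0# ∎

    -- The shift by `h` leaves the sum over a full period unchanged, yet multiplies it by κ. The
    -- vanishing in `∑e`, `∑proper` and `e-sum` comes from this.
    ∑mod-eigen : ∀ {d} {{_ : NonZero d}} {f κ} h → Periodic d f → (∀ a → f (a ℤ.+ h) ≈ κ * f a) → ¬ κ ≈ 1# → ∑mod d f ≈ 0#
    ∑mod-eigen {d} {f} {κ} h per shift κ≉1 = fixed⇒zero κ≉1 (trans (∑mod-*ˡ d κ f)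
      (trans (∑mod-cong d λ a → sym (shift a)) (∑mod-shift per h)))

    ∑e : ∀ x → ∑mod n (λ a → e (a ℤ.* x)) ≈ fromℕ F n * δ n x 0ℤ
    ∑e x with ≋? n x 0ℤ
    ... | yes x≋0 = trans (∑mod-cong n λ a → e-≋0 (≋-trans (≋-* (≋-refl {a = a}) x≋0) (≋-reflexive (ℤP.*-zeroʳ a))))
                      (trans (∑mod-1 n) (sym (*-identityʳ _)))
    ... | no x≉0 = trans (∑mod-eigen 1ℤ (λ a≋b → e-periodic (≋-* a≋b ≋-refl))
                     (λ a → trans (reflexive (≡.cong e (lemma a x))) (e-+ x (a ℤ.* x))) (λ p → x≉0 (e≈1⇒≋0 x p)))
                     (sym (zeroʳ _))
      where
      lemma : ∀ a x → (a ℤ.+ 1ℤ) ℤ.* x ≡ x ℤ.+ a ℤ.* x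
      lemma = solve-∀

    -- Fourier coefficients of χ and ν at units and at non-units.

    -- As b is a unit, e(T b) = 1 would force n ∣ T, whereas 0 < T < T p = n.
    e-proper : ∀ {T p b} → 2 ≤ p → T ℕ.* p ≡ n → CoprimeTo b n → ¬ e (+ T ℤ.* b) ≈ 1#
    e-proper {T} {p} {b} 2≤p Tp≡n b⊥n eTb≈1 = T≢0 (e≈1⇒≋0 (+ T ℤ.* b) eTb≈1)
      where
      instance
        T-nonZero : NonZero T
        T-nonZero = ℕP.m*n≢0⇒m≢0 T {{≡.subst NonZero (≡.sym Tp≡n) it}}
      T≢0 : ¬ + T ℤ.* b ≋ 0ℤ [ n ]
      T≢0 Tb≋0 = ℕP.<-irrefl ≡.refl (ℕP.<-≤-trans (≡.subst (T <_) Tp≡n (ℕP.m<m*n T p 2≤p))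
        (ℕD.∣⇒≤ (≋0⇒∣ (≋-trans (≋-sym (≋-*-inverse (+ T) (proj₂ (coprime⇒invertible b b⊥n))))
          (≋-* {_} {+ T ℤ.* b} {0ℤ} {proj₁ (coprime⇒invertible b b⊥n)} Tb≋0 ≋-refl)))))

    -- The shift by `T` fixes `g` and multiplies e(a b) by e(T b), which differs from 1 by
    -- `e-proper`.
    ∑proper : ∀ {T p b g} → Periodic T g → 2 ≤ p → T ℕ.* p ≡ n → CoprimeTo b n → ∑mod n (λ a → g a * e (a ℤ.* b)) ≈ 0#
    ∑proper {T} {p} {b} {g} per 2≤p Tp≡n b⊥n = ∑mod-eigen (+ T)
      (λ a≋b → *-cong (per (≋-weaken T∣n a≋b)) (e-periodic (≋-* a≋b (≋-refl {a = b}))))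
      (λ a → begin
        g (a ℤ.+ + T) * e ((a ℤ.+ + T) ℤ.* b)
          ≈⟨ *-cong (per (shift a)) (trans (reflexive (≡.cong e (ℤP.*-distribʳ-+ b a (+ T)))) (e-+ (a ℤ.* b) (+ T ℤ.* b))) ⟩
        g a * (e (a ℤ.* b) * e (+ T ℤ.* b))
          ≈⟨ trans (sym (*-assoc _ _ _)) (*-comm _ _) ⟩
        e (+ T ℤ.* b) * (g a * e (a ℤ.* b)) ∎)
      (e-proper {T} {p} {b} 2≤p Tp≡n b⊥n)
      where
      T∣n : T ℕD.∣ n
      T∣n = divides p (≡.trans (≡.sym Tp≡n) (ℕP.*-comm T p))
      shift : ∀ a → a ℤ.+ + T ≋ a [ T ]
      shift a = ≋-trans (≋-+ (≋-refl {a = a}) (∣⇒≋0 ℤD.∣-refl)) (≋-reflexive (ℤP.+-identityʳ a))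

    -- Expanding χ = ∏ (1 + ν_p), every term other than ∏ ν_p is periodic modulo a proper divisor of n.
    ∑χ≈∑ν : ∀ ps T {g b} → Periodic T g → All Prime ps → T ℕ.* product ps ≡ n → CoprimeTo b n →
      ∑mod n (λ a → g a * (χ ps a * e (a ℤ.* b))) ≈ ∑mod n (λ a → g a * (ν ps a * e (a ℤ.* b)))
    ∑χ≈∑ν [] T per _ _ _ = refl
    ∑χ≈∑ν (p ∷ ps) T {g} {b} per (p-prime ∷ primes) T*Π≡n b⊥n = begin
      ∑mod n (λ a → g a * ((1# + ν₁ p a) * χ ps a * e (a ℤ.* b)))
        ≈⟨ trans (∑mod-cong n λ a → expand (g a) (ν₁ p a) (χ ps a) (e (a ℤ.* b))) (∑mod-+ n _ _) ⟩
      ∑mod n (λ a → g a * χ ps a * e (a ℤ.* b)) + ∑mod n (λ a → g a * ν₁ p a * (χ ps a * e (a ℤ.* b)))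
        -- The term with 1 has period T times the product of `ps`, which is n / p, so its sum
        -- vanishes. In the other term ν_p is absorbed into `g`, whose period grows to T p.
        ≈⟨ +-cong
             (∑proper {T ℕ.* product ps} {p} {b}
               (periodic-* {f = g} {χ ps} (periodic-weaken {f = g} (ℕD.m∣m*n (product ps)) per)
                 (periodic-weaken {f = χ ps} (ℕD.n∣m*n T) (χ-periodic ps)))
               (prime⇒2≤ p-prime) (≡.trans (rotate T (product ps) p) T*Π≡n) b⊥n)
             (∑χ≈∑ν ps (T ℕ.* p) {λ a → g a * ν₁ p a} {b}
               (periodic-* {f = g} {ν₁ p} (periodic-weaken {f = g} (ℕD.m∣m*n p) per)
                 (periodic-weaken {f = ν₁ p} (ℕD.n∣m*n T) (ν₁-periodic p)))
               primes (≡.trans (ℕP.*-assoc T p (product ps)) T*Π≡n) b⊥n) ⟩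
      0# + ∑mod n (λ a → g a * ν₁ p a * (ν ps a * e (a ℤ.* b)))
        ≈⟨ trans (+-identityˡ _) (∑mod-cong n λ a → assoc (g a) (ν₁ p a) (ν ps a) (e (a ℤ.* b))) ⟩
      ∑mod n (λ a → g a * (ν₁ p a * ν ps a * e (a ℤ.* b))) ∎
      where
      expand : ∀ g v x e → g * ((1# + v) * x * e) ≈ g * x * e + g * v * (x * e)
      expand = solve 4 (λ g v x e → g :* ((con 1 :+ v) :* x :* e) := g :* x :* e :+ g :* v :* (x :* e)) refl
      assoc : ∀ g v x e → g * v * (x * e) ≈ g * (v * x * e)
      assoc = solve 4 (λ g v x e → g :* v :* (x :* e) := g :* (v :* x :* e)) refl
      rotate : ∀ x y z → x ℕ.* y ℕ.* z ≡ x ℕ.* (z ℕ.* y)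
      rotate x y z = ≡.trans (ℕP.*-assoc x y z) (≡.cong (x ℕ.*_) (ℕP.*-comm y z))

    -- The shift by h ≡ 0 (mod m), h ≡ 1 (mod p) exchanges the two indicators that make up ν_p.
    ∑ν₁-vanishes : ∀ {p m b g} → Periodic m g → p ℕ.* m ≡ n → Coprime p m → p ℕD.∣ ∣ b ∣ →
      ∑mod n (λ a → g a * (ν₁ p a * e (a ℤ.* b))) ≈ 0#
    ∑ν₁-vanishes {p} {m} {b} {g} per pm≡n p⊥m p∣b = +-identityˡ-unique _ _ (begin
      -- With S the sum in question and X the same sum with [a ≡ 0 (p)] in place of ν_p, the chain
      -- proves S + X = X: adding X turns ν_p into [a ≡ 1 (p)], and the shift by `h` turns this back
      -- into X.
      ∑mod n (λ a → g a * (ν₁ p a * e (a ℤ.* b))) + ∑mod n (f 0ℤ)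
        ≈⟨ ∑mod-+ n _ _ ⟨
      ∑mod n (λ a → g a * (ν₁ p a * e (a ℤ.* b)) + f 0ℤ a)
        ≈⟨ ∑mod-cong n (λ a → trans (collect (g a) (ν₁ p a) (e (a ℤ.* b)) (δ p a 0ℤ)) (*-congˡ (*-congʳ (cancel a)))) ⟩
      ∑mod n (f 1ℤ)
        ≈⟨ ∑mod-shift {f = f 1ℤ} (λ {a} {a'} a≋a' → *-cong (per (≋-weaken m∣n a≋a'))
             (*-cong (δ-cong (≋-weaken p∣n a≋a') ≋-refl) (e-periodic (≋-* a≋a' (≋-refl {a = b}))))) h ⟨
      ∑mod n (λ a → f 1ℤ (a ℤ.+ h))
        ≈⟨ ∑mod-cong n (λ a → *-cong (per (m-shift a)) (*-cong (p-shift a) (e-periodic (n-shift a)))) ⟩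
      ∑mod n (f 0ℤ) ∎)
      where
      f : ℤ → ℤ → Carrier
      f k a = g a * (δ p a k * e (a ℤ.* b))
      p∣n : p ℕD.∣ n
      p∣n = ≡.subst (p ℕD.∣_) pm≡n (ℕD.m∣m*n m)
      m∣n : m ℕD.∣ n
      m∣n = ≡.subst (m ℕD.∣_) pm≡n (ℕD.n∣m*n p)
      v : ℤ
      v = proj₁ (coprime⇒invertible (+ m) (Coprimality.sym p⊥m))
      h : ℤ
      h = + m ℤ.* v
      h≋1 : h ≋ 1ℤ [ p ]
      h≋1 = proj₂ (coprime⇒invertible (+ m) (Coprimality.sym p⊥m))
      h≋0 : h ≋ 0ℤ [ m ]
      h≋0 = ≋-* {m} {+ m} {0ℤ} {v} {v} (∣⇒≋0 ℤD.∣-refl) ≋-refl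
      collect : ∀ g v e d → g * (v * e) + g * (d * e) ≈ g * ((v + d) * e)
      collect = solve 4 (λ g v e d → g :* (v :* e) :+ g :* (d :* e) := g :* ((v :+ d) :* e)) refl
      cancel : ∀ a → ν₁ p a + δ p a 0ℤ ≈ δ p a 1ℤ
      cancel a = trans (+-assoc _ _ _) (trans (+-congˡ (-‿inverseˡ _)) (+-identityʳ _))
      m-shift : ∀ a → a ℤ.+ h ≋ a [ m ]
      m-shift a = ≋-trans (≋-+ (≋-refl {a = a}) h≋0) (≋-reflexive (ℤP.+-identityʳ a))
      p-shift : ∀ a → δ p (a ℤ.+ h) 1ℤ ≈ δ p a 0ℤ
      p-shift a = ⟦⟧-cong (≋? p (a ℤ.+ h) 1ℤ) (≋? p a 0ℤ)
        (λ a+h≋1 → ≋-trans (≋-reflexive (l a h)) (≋-trans (≋-- a+h≋1 h≋1) (≋-reflexive (ℤP.+-inverseʳ 1ℤ))))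
        (λ a≋0 → ≋-trans (≋-+ a≋0 h≋1) (≋-reflexive (ℤP.+-identityˡ 1ℤ)))
        where
        l : ∀ a h → a ≡ (a ℤ.+ h) ℤ.- h
        l = solve-∀
      -- p divides b and m divides h, so the shift by `h` does not change e(a b).
      hb≋0 : h ℤ.* b ≋ 0ℤ [ n ]
      hb≋0 = ≡.subst (h ℤ.* b ≋ 0ℤ [_]) pm≡n (≋-join p⊥m
        (≋-trans (≋-* (≋-refl {a = h}) (∣⇒≋0 (ℤD.∣ᵤ⇒∣ p∣b))) (≋-reflexive (ℤP.*-zeroʳ h)))
        (≋-* {m} {h} {0ℤ} {b} {b} h≋0 ≋-refl))
      n-shift : ∀ a → (a ℤ.+ h) ℤ.* b ≋ a ℤ.* b [ n ]
      n-shift a = ≋-trans (≋-reflexive (ℤP.*-distribʳ-+ b a h))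
        (≋-trans (≋-+ (≋-refl {a = a ℤ.* b}) hb≋0) (≋-reflexive (ℤP.+-identityʳ (a ℤ.* b))))

    -- The list is searched for a prime p dividing b, the factors ν_p passed over being absorbed
    -- into `g`. Once p is found, everything in front of ν_p e(a b) is periodic modulo n / p, and
    -- `∑ν₁-vanishes` applies.
    ∑ν-nonunit : SquareFree n → ∀ ps T {g b} → Periodic T g → All Prime ps → T ℕ.* product ps ≡ n →
      ¬ CoprimeTo b (product ps) → ∑mod n (λ a → g a * (ν ps a * e (a ℤ.* b))) ≈ 0#
    ∑ν-nonunit sf [] T {g} {b} _ _ _ ¬b⊥ = ⊥-elim (¬b⊥ (Coprimality.sym (Coprimality.1-coprimeTo ∣ b ∣)))
    ∑ν-nonunit sf (p ∷ ps) T {g} {b} per (p-prime ∷ primes) T*Π≡n ¬b⊥ with p ℕD.∣? ∣ b ∣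
    ... | yes p∣b = trans (∑mod-cong n λ a → regroup (g a) (ν₁ p a) (ν ps a) (e (a ℤ.* b)))
      (∑ν₁-vanishes {p} {T ℕ.* product ps} {b}
        (periodic-* {f = g} {ν ps} (periodic-weaken {f = g} (ℕD.m∣m*n (product ps)) per)
          (periodic-weaken {f = ν ps} (ℕD.n∣m*n T) (ν-periodic ps)))
        pm≡n (squareFree-coprime p-prime (≡.subst SquareFree (≡.sym pm≡n) sf)) p∣b)
      where
      regroup : ∀ g v x e → g * (v * x * e) ≈ g * x * (v * e)
      regroup = solve 4 (λ g v x e → g :* (v :* x :* e) := g :* x :* (v :* e)) refl
      pm≡n : p ℕ.* (T ℕ.* product ps) ≡ n
      pm≡n = ≡.trans (≡.sym (ℕP.*-assoc p T (product ps))) (≡.trans (≡.cong (ℕ._* product ps) (ℕP.*-comm p T))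
        (≡.trans (ℕP.*-assoc T p (product ps)) T*Π≡n))
    ... | no p∤b = trans (∑mod-cong n λ a → regroup (g a) (ν₁ p a) (ν ps a) (e (a ℤ.* b)))
      (∑ν-nonunit sf ps (T ℕ.* p) {λ a → g a * ν₁ p a} {b}
        (periodic-* {f = g} {ν₁ p} (periodic-weaken {f = g} (ℕD.m∣m*n p) per)
          (periodic-weaken {f = ν₁ p} (ℕD.n∣m*n T) (ν₁-periodic p)))
        primes (≡.trans (ℕP.*-assoc T p (product ps)) T*Π≡n)
        (λ b⊥ → ¬b⊥ (coprime-*ʳ (Coprimality.sym (∤⇒coprime p-prime p∤b)) b⊥)))
      where
      regroup : ∀ g v x e → g * (v * x * e) ≈ g * v * (x * e)
      regroup = solve 4 (λ g v x e → g :* (v :* x :* e) := g :* v :* (x :* e)) refl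

    -- Fourier inversion for square-free n.

    module _ (sf : SquareFree n) {N : ℕ} (n<N : n < N) where
      private
        ps : List ℕ
        ps = factors (factorise n)
        primes : All Prime ps
        primes = PrimeFactorisation.factorsPrime (factorise n)
        Π≡n : product ps ≡ n
        Π≡n = ≡.sym (PrimeFactorisation.isFactorisation (factorise n))

      private
        w*μ≈χₙ : ∀ a → w n a * μ N n a ≈ χ ps a
        w*μ≈χₙ a = ≡.subst (λ k → w k a * μ N k a ≈ χ ps a) Π≡n
          (w*μ≈χ ps N primes (≡.subst SquareFree (≡.sym Π≡n) sf) (≡.subst (_< N) (≡.sym Π≡n) n<N) a)

        ν≈δ : ∀ {t} → CoprimeTo t n → ν ps t ≈ δ n t 1ℤ
        ν≈δ {t} t⊥n = ≡.subst (λ k → ν ps t ≈ δ k t 1ℤ) Π≡n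
          (ν-unit ps primes (≡.subst SquareFree (≡.sym Π≡n) sf) {t} (≡.subst (CoprimeTo t) (≡.sym Π≡n) t⊥n))

        -- Splitting e((t - a) b) = e(t b) e(- a b) exhibits the Fourier transform of f at - b,
        -- weighted by k. It is used with k the indicator of the units, where the inner sum is a
        -- Ramanujan sum, and with k = 1. The factor `1#` stands for the `g` of `∑χ≈∑ν` and
        -- `∑ν-nonunit` at T = 1.
        swap : ∀ (k f : ℤ → Carrier) t → ∑mod n (λ a → f a * ∑mod n (λ b → k b * e ((t ℤ.- a) ℤ.* b))) ≈
          ∑mod n (λ b → k b * e (t ℤ.* b) * ∑mod n (λ a → 1# * (f a * e (a ℤ.* (ℤ.- b)))))
        swap k f t = begin
          ∑mod n (λ a → f a * ∑mod n (λ b → k b * e ((t ℤ.- a) ℤ.* b)))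
            ≈⟨ ∑mod-cong n (λ a → ∑mod-*ˡ n (f a) _) ⟩
          ∑mod n (λ a → ∑mod n λ b → f a * (k b * e ((t ℤ.- a) ℤ.* b)))
            ≈⟨ ∑mod-swap n n _ ⟩
          ∑mod n (λ b → ∑mod n λ a → f a * (k b * e ((t ℤ.- a) ℤ.* b)))
            ≈⟨ ∑mod-cong n (λ b → trans (∑mod-cong n λ a → trans
                 (*-congˡ (*-congˡ (trans (reflexive (≡.cong e (split t a b))) (e-+ (t ℤ.* b) (a ℤ.* (ℤ.- b))))))
                 (regroup (f a) (k b) (e (t ℤ.* b)) (e (a ℤ.* (ℤ.- b)))))
                 (sym (∑mod-*ˡ n _ _))) ⟩
          ∑mod n (λ b → k b * e (t ℤ.* b) * ∑mod n (λ a → 1# * (f a * e (a ℤ.* (ℤ.- b))))) ∎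
          where
          split : ∀ t a b → (t ℤ.- a) ℤ.* b ≡ t ℤ.* b ℤ.+ a ℤ.* (ℤ.- b)
          split = solve-∀
          regroup : ∀ f k x y → f * (k * (x * y)) ≈ k * x * (1# * (f * y))
          regroup = solve 4 (λ f k x y → f :* (k :* (x :* y)) := k :* x :* (con 1 :* (f :* y))) refl

        -- Cutting the transform of χ off to the units gives the whole transform of ν: at units the
        -- two agree, and at non-units that of ν is 0.
        spectrum : ∀ t b → w n b * e (t ℤ.* b) * ∑mod n (λ a → 1# * (χ ps a * e (a ℤ.* (ℤ.- b)))) ≈
          1# * e (t ℤ.* b) * ∑mod n (λ a → 1# * (ν ps a * e (a ℤ.* (ℤ.- b))))
        spectrum t b with Coprimality.coprime? ∣ b ∣ n
        ... | yes b⊥n = *-congˡ (∑χ≈∑ν ps 1 {b = ℤ.- b} (λ _ → refl) primes (≡.trans (ℕP.*-identityˡ _) Π≡n) (coprime-neg {n} b b⊥n))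
        ... | no ¬b⊥n = trans (trans (*-congʳ (zeroˡ _)) (zeroˡ _)) (sym (trans
                (*-congˡ (∑ν-nonunit sf ps 1 {b = ℤ.- b} (λ _ → refl) primes (≡.trans (ℕP.*-identityˡ _) Π≡n)
                  λ -b⊥ → ¬b⊥n (≡.subst (λ k → Coprime k n) (ℤP.∣-i∣≡∣i∣ b) (≡.subst (CoprimeTo (ℤ.- b)) Π≡n -b⊥))))
                (zeroʳ _)))

      ∑units-μ-e : ∀ {t} → CoprimeTo t n →
        ∑units n (λ a → μ N n a * ∑units n (λ b → e ((t ℤ.- a) ℤ.* b))) ≈ fromℕ F n * δ n t 1ℤ
      ∑units-μ-e {t} t⊥n = begin
        ∑units n (λ a → μ N n a * ∑units n (λ b → e ((t ℤ.- a) ℤ.* b)))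
          ≈⟨ ∑mod-cong n (λ a → trans (sym (*-assoc _ _ _)) (*-congʳ (w*μ≈χₙ a))) ⟩
        ∑mod n (λ a → χ ps a * ∑mod n (λ b → w n b * e ((t ℤ.- a) ℤ.* b)))
          ≈⟨ swap (w n) (χ ps) t ⟩
        ∑mod n (λ b → w n b * e (t ℤ.* b) * ∑mod n (λ a → 1# * (χ ps a * e (a ℤ.* (ℤ.- b)))))
          ≈⟨ ∑mod-cong n (spectrum t) ⟩
        ∑mod n (λ b → 1# * e (t ℤ.* b) * ∑mod n (λ a → 1# * (ν ps a * e (a ℤ.* (ℤ.- b)))))
          ≈⟨ swap (λ _ → 1#) (ν ps) t ⟨
        ∑mod n (λ a → ν ps a * ∑mod n (λ b → 1# * e ((t ℤ.- a) ℤ.* b)))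
          -- The inner sum now runs over all residues b, so orthogonality makes it n
          -- [a ≡ t (mod n)].
          ≈⟨ ∑mod-cong n (λ a → trans
               (*-congˡ (trans (∑mod-cong n λ b → trans (*-identityˡ _) (reflexive (≡.cong e (ℤP.*-comm (t ℤ.- a) b)))) (∑e (t ℤ.- a))))
               (trans (*-congˡ (*-congˡ (difference-δ a))) (regroup (ν ps a) (fromℕ F n) (δ n a t)))) ⟩
        ∑mod n (λ a → fromℕ F n * (δ n a t * ν ps a))
          ≈⟨ ∑mod-*ˡ n (fromℕ F n) _ ⟨
        fromℕ F n * ∑mod n (λ a → δ n a t * ν ps a)
          ≈⟨ *-congˡ (∑mod-δ (periodic-weaken {f = ν ps} (ℕD.∣-reflexive Π≡n) (ν-periodic ps)) t) ⟩
        fromℕ F n * ν ps t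
          ≈⟨ *-congˡ (ν≈δ {t} t⊥n) ⟩
        fromℕ F n * δ n t 1ℤ ∎
        where
        regroup : ∀ x y z → x * (y * z) ≈ y * (z * x)
        regroup = solve 3 (λ x y z → x :* (y :* z) := y :* (z :* x)) refl
        difference-δ : ∀ a → δ n (t ℤ.- a) 0ℤ ≈ δ n a t
        difference-δ a = ⟦⟧-cong (≋? n (t ℤ.- a) 0ℤ) (≋? n a t)
          (λ d → ≋-sym (≋-trans (≋-reflexive (l t a)) (≋-trans (≋-+ d (≋-refl {a = a})) (≋-reflexive (ℤP.+-identityˡ a)))))
          (λ a≋t → ≋-trans (≋-- (≋-refl {a = t}) a≋t) (≋-reflexive (ℤP.+-inverseʳ t)))
          where
          l : ∀ t a → t ≡ (t ℤ.- a) ℤ.+ a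
          l = solve-∀

    -- From λ and ρ to the divisor count μ.

    sumF≈sum : ∀ m f → sumF F m f ≈ sum f
    sumF≈sum zero f = refl
    sumF≈sum (suc m) f = +-congˡ (sumF≈sum m λ i → f (Fin.suc i))

    fromℕ-+ : ∀ i j → fromℕ F (i ℕ.+ j) ≈ fromℕ F i + fromℕ F j
    fromℕ-+ zero j = sym (+-identityˡ _)
    fromℕ-+ (suc i) j = trans (+-congˡ (fromℕ-+ i j)) (sym (+-assoc _ _ _))

    fromℕ-filter : ∀ {p} {P : ℕ → Set p} (P? : Decidable P) (f : ℕ → ℕ) k →
      fromℕ F (length (filter P? (applyUpTo f k))) ≈ sum {k} (λ i → ⟦ P? (f (toℕ i)) ⟧)
    fromℕ-filter P? f zero = refl
    fromℕ-filter P? f (suc k) with P? (f 0) | fromℕ-filter P? (λ i → f (suc i)) k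
    ... | yes _ | ih = +-congˡ ih
    ... | no _ | ih = trans ih (sym (+-identityˡ _))

    private
      -- Divisors run over 0, ..., n, so that q = n is included, as in `lam`.
      N : ℕ
      N = suc n

    -- ρ n counts the divisors q ∈ {1, 2} of n, omitted by lam, once for k and once for - k.
    small : Carrier
    small = 1# + ⟦ 2 ℕD.∣? n ⟧

    fromℕ-ρ : fromℕ F (ρ n) ≈ small + small
    fromℕ-ρ with ρ-cases n
    ... | inj₁ (2∣n , ρ≡4) = trans (trans (reflexive (≡.cong (fromℕ F) ρ≡4)) four) (sym (+-cong two two))
      where
      two : small ≈ 1# + 1#
      two = +-congˡ (⟦⟧-yes (2 ℕD.∣? n) 2∣n)
      four : 1# + (1# + (1# + (1# + 0#))) ≈ (1# + 1#) + (1# + 1#)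
      four = trans (+-congˡ (+-congˡ (+-congˡ (+-identityʳ 1#)))) (sym (+-assoc _ _ _))
    ... | inj₂ (2∤n , ρ≡2) = trans (reflexive (≡.cong (fromℕ F) ρ≡2)) (trans (+-congˡ (+-identityʳ 1#)) (sym (+-cong one one)))
      where
      one : small ≈ 1#
      one = trans (+-congˡ (⟦⟧-no (2 ℕD.∣? n) 2∤n)) (+-identityʳ 1#)

    -- `lam` starts at q = 3. The divisor 1 always counts for μ, and 2 counts whenever it divides n,
    -- because k, being coprime to n, is then odd.
    μ-lam : ∀ {k} → CoprimeTo k n → μ N n k ≈ fromℕ F (lam n k) + small
    μ-lam {k} k⊥n = begin
      μ N n k
        ≈⟨ sum-cong {N} (λ q → split (toℕ q)) ⟩
      sum {N} (λ q → ⟦ λ-cond? n k (toℕ q) ⟧ + extra (toℕ q))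
        ≈⟨ ∑-distrib-+ {N} (λ q → ⟦ λ-cond? n k (toℕ q) ⟧) (λ q → extra (toℕ q)) ⟩
      sum {N} (λ q → ⟦ λ-cond? n k (toℕ q) ⟧) + sum {N} (λ q → extra (toℕ q))
        ≈⟨ +-cong (sym (fromℕ-filter (λ-cond? n k) (λ q → q) N)) (sum-extra 3≤n) ⟩
      fromℕ F (lam n k) + small ∎
      where
      extra : ℕ → Carrier
      extra 0 = 0#
      extra 1 = 1#
      extra 2 = ⟦ 2 ℕD.∣? n ⟧
      extra (suc (suc (suc _))) = 0#
      sum-extra : ∀ {m} → 3 ≤ m → sum {suc m} (λ q → extra (toℕ q)) ≈ small
      sum-extra (s≤s (s≤s (s≤s {n = m} _))) = trans (+-identityˡ _) (+-congˡ (trans (+-congˡ (sum-zero {suc m} λ _ → refl)) (+-identityʳ _)))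
      below : ∀ q → ¬ 3 ≤ q → ⟦ λ-cond? n k q ⟧ + extra q ≈ extra q
      below q q<3 = trans (+-congʳ (⟦⟧-no (λ-cond? n k q) λ h → q<3 (proj₁ h))) (+-identityˡ _)
      odd : 2 ℕD.∣ n → k ≋ 1ℤ [ 2 ]
      odd 2∣n with residue 2 k
      ... | Fin.zero , 0≋k = contradiction (k⊥n (≋0⇒∣ (≋-sym 0≋k) , 2∣n)) λ ()
      ... | Fin.suc Fin.zero , 1≋k = ≋-sym 1≋k
      split : ∀ q → ⟦ q ℕD.∣? n ⟧ * δ q k 1ℤ ≈ ⟦ λ-cond? n k q ⟧ + extra q
      split 0 = trans (trans (*-congʳ (⟦⟧-no (0 ℕD.∣? n) λ 0∣n → ℕ.≢-nonZero⁻¹ n (ℕD.0∣⇒≡0 0∣n))) (zeroˡ _))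
        (sym (below 0 λ ()))
      split 1 = trans (trans (*-cong (⟦⟧-yes (1 ℕD.∣? n) (ℕD.1∣ n)) (δ-1 k 1ℤ)) (*-identityˡ 1#)) (sym (below 1 λ { (s≤s ()) }))
      split 2 = trans (⟦⟧-* (2 ℕD.∣? n) (≋? 2 k 1ℤ) (2 ℕD.∣? n) (λ 2∣n _ → 2∣n) (λ 2∣n → 2∣n , odd 2∣n))
        (sym (below 2 λ { (s≤s (s≤s ())) }))
      split q@(suc (suc (suc _))) = trans
        (⟦⟧-* (q ℕD.∣? n) (≋? q k 1ℤ) (λ-cond? n k q) (λ q∣n e → s≤s (s≤s (s≤s z≤n)) , q∣n , difference e)
          (λ h → proj₁ (proj₂ h) , cong (proj₂ (proj₂ h))))
        (sym (+-identityʳ _))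

    weight-μ : ∀ {k} → CoprimeTo k n → fromℕ F (lam n k ℕ.+ lam n (ℤ.- k) ℕ.+ ρ n) ≈ μ N n k + μ N n (ℤ.- k)
    weight-μ {k} k⊥n = begin
      fromℕ F (lam n k ℕ.+ lam n (ℤ.- k) ℕ.+ ρ n)
        ≈⟨ trans (fromℕ-+ (lam n k ℕ.+ lam n (ℤ.- k)) (ρ n)) (+-cong (fromℕ-+ (lam n k) (lam n (ℤ.- k))) fromℕ-ρ) ⟩
      fromℕ F (lam n k) + fromℕ F (lam n (ℤ.- k)) + (small + small)
        ≈⟨ regroup _ _ _ ⟩
      (fromℕ F (lam n k) + small) + (fromℕ F (lam n (ℤ.- k)) + small)
        ≈⟨ +-cong (μ-lam {k} k⊥n) (μ-lam {ℤ.- k} (coprime-neg {n} k k⊥n)) ⟨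
      μ N n k + μ N n (ℤ.- k) ∎
      where
      regroup : ∀ x y z → x + y + (z + z) ≈ (x + z) + (y + z)
      regroup = solve 3 (λ x y z → x :+ y :+ (z :+ z) := (x :+ z) :+ (y :+ z)) refl

    -- Cosine sums over representatives.

    cos : ℤ → Carrier
    cos = cosC F n ζ

    cos-periodic : Periodic n cos
    cos-periodic a≋b = +-cong (e-periodic a≋b) (e-periodic (≋-neg a≋b))

    cos-even : ∀ a → cos (ℤ.- a) ≈ cos a
    cos-even a = trans (+-congˡ (reflexive (≡.cong e (ℤP.neg-involutive a)))) (+-comm _ _)

    cos-≡± : ∀ {a b} → a ≡± b [mod n ] → cos a ≈ cos b
    cos-≡± {a} {b} (inj₁ p) = cos-periodic (cong {a} {b} p)
    cos-≡± {a} {b} (inj₂ p) = trans (cos-periodic (cong {a} {ℤ.- b} p)) (cos-even b)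

    -- As the cosine is even, the sum over representatives unfolds to one over all units, and a is
    -- then replaced by a u. In a matrix product, u is chosen so that the summation index k occurs
    -- only in cos(a u), while v no longer depends on k.
    cHat-units : ∀ {m r} → IsRepSystem n m r → ∀ ninv x {u u' v} → u ℤ.* u' ≋ 1ℤ [ n ] → CoprimeTo x n → u ℤ.* x ≋ v [ n ] →
      cHat F n m ζ r ninv x ≈ ninv * ∑units n (λ a → μ N n (a ℤ.* v) * cos (a ℤ.* u))
    cHat-units {m} {r} reps ninv x {u} {u'} {v} uu' x⊥n ux≋v = *-congˡ (begin
      sumF F m (λ l → fromℕ F (lam n (r l ℤ.* x) ℕ.+ lam n (ℤ.- (r l ℤ.* x)) ℕ.+ ρ n) * cos (r l))
        ≈⟨ sumF≈sum m _ ⟩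
      sum {m} (λ l → fromℕ F (lam n (r l ℤ.* x) ℕ.+ lam n (ℤ.- (r l ℤ.* x)) ℕ.+ ρ n) * cos (r l))
        ≈⟨ sum-cong {m} (λ l → trans (*-congʳ (weight-μ {r l ℤ.* x} (coprime-* {n} {r l} {x} (proj₁ reps l) x⊥n)))
             (trans (distribʳ _ _ _) (+-congˡ (*-cong (reflexive (≡.cong (μ N n) (ℤP.neg-distribˡ-* (r l) x))) (sym (cos-even (r l))))))) ⟩
      sum {m} (λ l → f (r l) + f (ℤ.- r l))
        ≈⟨ ∑units-reps 3≤n {m} {r} reps {f} f-periodic ⟩
      ∑units n f
        ≈⟨ ∑units-scale u u' f-periodic uu' ⟨
      ∑units n (λ a → f (a ℤ.* u))
        ≈⟨ ∑units-cong n (λ a _ → *-congʳ (μ-periodic N n (≋-trans (≋-reflexive (ℤP.*-assoc a u x)) (≋-* (≋-refl {a = a}) ux≋v)))) ⟩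
      ∑units n (λ a → μ N n (a ℤ.* v) * cos (a ℤ.* u)) ∎)
      where
      f : ℤ → Carrier
      f a = μ N n (a ℤ.* x) * cos a
      f-periodic : Periodic n f
      f-periodic a≋b = *-cong (μ-periodic N n (≋-* a≋b (≋-refl {a = x}))) (cos-periodic a≋b)

    private
      -- The Ramanujan sum modulo n.
      I : ℤ → Carrier
      I x = ∑units n (λ b → e (x ℤ.* b))

      I-periodic : Periodic n I
      I-periodic x≋y = ∑units-cong n λ b _ → e-periodic (≋-* x≋y (≋-refl {a = b}))

      I-scale : ∀ x u u' → u ℤ.* u' ≋ 1ℤ [ n ] → I (x ℤ.* u) ≈ I x
      I-scale x u u' uu' = trans
        (∑units-cong n λ b _ → reflexive (≡.cong e (l x u b)))
        (∑units-scale u u' (λ b≋c → e-periodic (≋-* (≋-refl {a = x}) b≋c)) uu')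
        where
        l : ∀ x u b → (x ℤ.* u) ℤ.* b ≡ x ℤ.* (b ℤ.* u)
        l = solve-∀

    -- The product-to-sum formula writes each summand as f(b) + f(- b) with f(b) = e((y + a) b) +
    -- e((y - a) b), so `∑units-reps` turns the sum into two Ramanujan sums.
    cos*cos : ∀ {m q} → IsRepSystem n m q → ∀ y a → sum {m} (λ k → cos (y ℤ.* q k) * cos (a ℤ.* q k)) ≈ I (y ℤ.+ a) + I (y ℤ.- a)
    cos*cos {m} {q} reps y a = begin
      sum {m} (λ k → cos (y ℤ.* q k) * cos (a ℤ.* q k))
        ≈⟨ sum-cong {m} (λ k → product-to-sum (q k)) ⟩
      sum {m} (λ k → f (q k) + f (ℤ.- q k))
        ≈⟨ ∑units-reps 3≤n {m} {q} reps {f} (λ b≋c → +-cong (e-periodic (≋-* (≋-refl {a = y ℤ.+ a}) b≋c)) (e-periodic (≋-* (≋-refl {a = y ℤ.- a}) b≋c))) ⟩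
      ∑units n f
        ≈⟨ trans (∑mod-cong n λ b → distribˡ _ _ _) (∑mod-+ n _ _) ⟩
      I (y ℤ.+ a) + I (y ℤ.- a) ∎
      where
      f : ℤ → Carrier
      f b = e ((y ℤ.+ a) ℤ.* b) + e ((y ℤ.- a) ℤ.* b)
      e-* : ∀ {x} u v → u ℤ.+ v ≡ x → e u * e v ≈ e x
      e-* u v eq = trans (sym (e-+ u v)) (reflexive (≡.cong e eq))
      expand : ∀ x y z w → (x + y) * (z + w) ≈ (x * z + x * w) + (y * w + y * z)
      expand = solve 4 (λ x y z w → (x :+ y) :* (z :+ w) := (x :* z :+ x :* w) :+ (y :* w :+ y :* z)) refl
      product-to-sum : ∀ b → cos (y ℤ.* b) * cos (a ℤ.* b) ≈ f b + f (ℤ.- b)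
      product-to-sum b = trans (expand _ _ _ _) (+-cong
        (+-cong (e-* (y ℤ.* b) (a ℤ.* b) (l₁ y a b)) (e-* (y ℤ.* b) (ℤ.- (a ℤ.* b)) (l₂ y a b)))
        (+-cong (e-* (ℤ.- (y ℤ.* b)) (ℤ.- (a ℤ.* b)) (l₃ y a b)) (e-* (ℤ.- (y ℤ.* b)) (a ℤ.* b) (l₄ y a b))))
        where
        l₁ : ∀ y a b → y ℤ.* b ℤ.+ a ℤ.* b ≡ (y ℤ.+ a) ℤ.* b
        l₁ = solve-∀
        l₂ : ∀ y a b → y ℤ.* b ℤ.+ ℤ.- (a ℤ.* b) ≡ (y ℤ.- a) ℤ.* b
        l₂ = solve-∀
        l₃ : ∀ y a b → ℤ.- (y ℤ.* b) ℤ.+ ℤ.- (a ℤ.* b) ≡ (y ℤ.+ a) ℤ.* (ℤ.- b)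
        l₃ = solve-∀
        l₄ : ∀ y a b → ℤ.- (y ℤ.* b) ℤ.+ a ℤ.* b ≡ (y ℤ.- a) ℤ.* (ℤ.- b)
        l₄ = solve-∀

    -- The entries of the matrix products.

    module _ (sf : SquareFree n) {ninv : Carrier} (n*ninv≈1 : fromℕ F n * ninv ≈ 1#) where

      -- The common form of the entries of both products of the two matrices. Summing over k first
      -- leaves Ramanujan sums weighted by μ; after replacing a v by a, `∑units-μ-e` evaluates them
      -- at t and - t, where t = y v.
      convolution : ∀ {m q} → IsRepSystem n m q → ∀ {v v'} → v ℤ.* v' ≋ 1ℤ [ n ] → ∀ {y} → CoprimeTo y n →
        sum {m} (λ k → cos (y ℤ.* q k) * (ninv * ∑units n (λ a → μ N n (a ℤ.* v) * cos (a ℤ.* q k)))) ≈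
        δ n (y ℤ.* v) 1ℤ + δ n (y ℤ.* v) (ℤ.- 1ℤ)
      convolution {m} {q} reps {v} {v'} vv' {y} y⊥n = begin
        sum {m} (λ k → cos (y ℤ.* q k) * (ninv * ∑units n (λ a → μ N n (a ℤ.* v) * cos (a ℤ.* q k))))
          ≈⟨ sum-cong {m} (λ k → trans (exchange _ _ _) (*-congˡ (∑mod-*ˡ n _ _))) ⟩
        sum {m} (λ k → ninv * ∑mod n (λ a → cos (y ℤ.* q k) * (w n a * (μ N n (a ℤ.* v) * cos (a ℤ.* q k)))))
          ≈⟨ *-distribˡ-sum {m} ninv _ ⟨
        ninv * sum {m} (λ k → ∑mod n (λ a → cos (y ℤ.* q k) * (w n a * (μ N n (a ℤ.* v) * cos (a ℤ.* q k)))))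
          ≈⟨ *-congˡ (∑mod-∑-swap n {m} _) ⟩
        ninv * ∑mod n (λ a → sum {m} (λ k → cos (y ℤ.* q k) * (w n a * (μ N n (a ℤ.* v) * cos (a ℤ.* q k)))))
          ≈⟨ *-congˡ (∑mod-cong n λ a → trans
               (sum-cong {m} λ k → regroup (cos (y ℤ.* q k)) (w n a) (μ N n (a ℤ.* v)) (cos (a ℤ.* q k)))
               (trans (sym (*-distribˡ-sum {m} (w n a * μ N n (a ℤ.* v)) _))
               (trans (*-congˡ (cos*cos reps y a)) (*-assoc _ _ _)))) ⟩
        ninv * ∑units n (λ a → μ N n (a ℤ.* v) * (I (y ℤ.+ a) + I (y ℤ.- a)))
          -- A Ramanujan sum is unchanged when its argument is multiplied by a unit: - v for y + a,
          -- and v for y - a. Both then depend on a only through a v.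
          ≈⟨ *-congˡ (∑units-cong n λ a _ → *-congˡ (+-cong (rescale-+ a) (rescale-- a))) ⟩
        ninv * ∑units n (λ a → f (a ℤ.* v))
          ≈⟨ *-congˡ (∑units-scale v v' f-periodic vv') ⟩
        ninv * ∑units n f
          ≈⟨ *-congˡ (trans (∑mod-cong n λ a → trans (*-congˡ (distribˡ _ _ _)) (distribˡ _ _ _)) (∑mod-+ n _ _)) ⟩
        ninv * (∑units n (λ a → μ N n a * I (ℤ.- t ℤ.- a)) + ∑units n (λ a → μ N n a * I (t ℤ.- a)))
          ≈⟨ *-congˡ (+-cong (∑units-μ-e sf {N} ℕP.≤-refl {ℤ.- t} (coprime-neg {n} t t⊥n)) (∑units-μ-e sf {N} ℕP.≤-refl {t} t⊥n)) ⟩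
        ninv * (fromℕ F n * δ n (ℤ.- t) 1ℤ + fromℕ F n * δ n t 1ℤ)
          ≈⟨ cancel _ _ ⟩
        δ n t 1ℤ + δ n (ℤ.- t) 1ℤ
          ≈⟨ +-congˡ (⟦⟧-cong (≋? n (ℤ.- t) 1ℤ) (≋? n t (ℤ.- 1ℤ))
               (λ h → ≋-trans (≋-reflexive (≡.sym (ℤP.neg-involutive t))) (≋-neg h)) ≋-neg) ⟩
        δ n t 1ℤ + δ n t (ℤ.- 1ℤ) ∎
        where
        t : ℤ
        t = y ℤ.* v
        t⊥n : CoprimeTo t n
        t⊥n = coprime-* {n} {y} {v} y⊥n (invertible⇒coprime {n} {v} v' vv')
        f : ℤ → Carrier
        f a = μ N n a * (I (ℤ.- t ℤ.- a) + I (t ℤ.- a))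
        f-periodic : Periodic n f
        f-periodic a≋b = *-cong (μ-periodic N n a≋b)
          (+-cong (I-periodic (≋-- (≋-refl {a = ℤ.- t}) a≋b)) (I-periodic (≋-- (≋-refl {a = t}) a≋b)))
        rescale-+ : ∀ a → I (y ℤ.+ a) ≈ I (ℤ.- t ℤ.- a ℤ.* v)
        rescale-+ a = trans (sym (I-scale (y ℤ.+ a) (ℤ.- v) (ℤ.- v') (≋-trans (≋-reflexive (l₁ v v')) vv')))
          (reflexive (≡.cong I (l₂ y a v)))
          where
          l₁ : ∀ v v' → ℤ.- v ℤ.* ℤ.- v' ≡ v ℤ.* v'
          l₁ = solve-∀
          l₂ : ∀ y a v → (y ℤ.+ a) ℤ.* (ℤ.- v) ≡ ℤ.- (y ℤ.* v) ℤ.- a ℤ.* v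
          l₂ = solve-∀
        rescale-- : ∀ a → I (y ℤ.- a) ≈ I (t ℤ.- a ℤ.* v)
        rescale-- a = trans (sym (I-scale (y ℤ.- a) v v' vv')) (reflexive (≡.cong I (l y a v)))
          where
          l : ∀ y a v → (y ℤ.- a) ℤ.* v ≡ y ℤ.* v ℤ.- a ℤ.* v
          l = solve-∀
        exchange : ∀ x y z → x * (y * z) ≈ y * (x * z)
        exchange = solve 3 (λ x y z → x :* (y :* z) := y :* (x :* z)) refl
        regroup : ∀ x w m z → x * (w * (m * z)) ≈ w * m * (x * z)
        regroup = solve 4 (λ x w m z → x :* (w :* (m :* z)) := w :* m :* (x :* z)) refl
        cancel : ∀ x z → ninv * (fromℕ F n * x + fromℕ F n * z) ≈ z + x
        cancel x z = trans (factor ninv (fromℕ F n) x z) (trans (*-congʳ n*ninv≈1) (*-identityˡ _))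
          where
          factor : ∀ i k x z → i * (k * x + k * z) ≈ k * i * (z + x)
          factor = solve 4 (λ i k x z → i :* (k :* x :+ k :* z) := k :* i :* (z :+ x)) refl

    -- The inverse matrix and the necessity of square-freeness.

    idM≈⟦⟧ : ∀ m (i j : Fin m) → idM F m i j ≈ ⟦ i Fin.≟ j ⟧
    idM≈⟦⟧ m i j with i Fin.≟ j
    ... | yes _ = refl
    ... | no _ = refl

    module _ {m : ℕ} {r s : Fin m → ℤ} (reps : IsRepSystem n m r) (rs : ∀ k → r k ℤ.* s k ≋ 1ℤ [ n ]) where

      sr : ∀ k → s k ℤ.* r k ≋ 1ℤ [ n ]
      sr k = ≋-comm-* {u = r k} (rs k)

      s⊥n : ∀ k → CoprimeTo (s k) n
      s⊥n k = invertible⇒coprime {n} {s k} (r k) (sr k)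

      ±-transfer : ∀ {u u' v v'} → u ℤ.* u' ≋ 1ℤ [ n ] → v ℤ.* v' ≋ 1ℤ [ n ] → u ≡± v [mod n ] → u' ≡± v' [mod n ]
      ±-transfer {u} {u'} {v} {v'} uu' vv' (inj₁ p) = inj₁ (difference (≋-cancelʳ-* {u = u} {u'} {u'} {v'} uu'
        (≋-trans (≋-comm-* {u = u} uu') (≋-sym (≋-trans (≋-* (≋-refl {a = v'}) (cong {u} {v} p)) (≋-comm-* {u = v} vv'))))))
      ±-transfer {u} {u'} {v} {v'} uu' vv' (inj₂ p) = inj₂ (difference (≋-cancelʳ-* {u = u} {u'} {u'} {ℤ.- v'} uu'
        (≋-trans (≋-comm-* {u = u} uu') (≋-sym (≋-trans (≋-* (≋-refl {a = ℤ.- v'}) (cong {u} {ℤ.- v} p))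
          (≋-trans (≋-reflexive (l v v')) vv'))))))
        where
        l : ∀ v v' → ℤ.- v' ℤ.* ℤ.- v ≡ v ℤ.* v'
        l = solve-∀

      -- In the product of C with Ĉ the summation index enters the cosines through `s k`, so sums
      -- over the inverses must unfold to sums over units as well.
      inverse-reps : IsRepSystem n m s
      inverse-reps = s⊥n , (λ i j h → proj₁ (proj₂ reps) i j (±-transfer {s i} {r i} {s j} {r j} (sr i) (sr j) h)) , covers
        where
        covers : ∀ u → CoprimeTo u n → ∃ λ i → s i ≡± u [mod n ]
        covers u u⊥n with coprime⇒invertible u u⊥n
        ... | u' , uu' with proj₂ (proj₂ reps) u' (invertible⇒coprime {n} {u'} u (≋-comm-* {u = u} uu'))
        ... | i , h = i , ±-transfer {r i} {s i} {u'} {u} (rs i) (≋-comm-* {u = u} uu') h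

      -- Multiplying by `r j` turns r_i s_j ≡ ± 1 into r_i ≡ ± r_j, which for representatives means
      -- i = j.
      δ-reps : ∀ i j → δ n (r i ℤ.* s j) 1ℤ + δ n (r i ℤ.* s j) (ℤ.- 1ℤ) ≈ idM F m i j
      δ-reps i j = trans
        (δ-± n {1ℤ} {r i ℤ.* s j} (i Fin.≟ j) (coprime-* {n} {r i} {s j} (proj₁ reps i) (s⊥n j)) 3≤n
          (λ h → proj₁ (proj₂ reps) i j (to h)) from)
        (sym (idM≈⟦⟧ m i j))
        where
        to : 1ℤ ≡± r i ℤ.* s j [mod n ] → r i ≡± r j [mod n ]
        to (inj₁ p) = inj₁ (difference (≋-cancelʳ-* {u = s j} {r j} {r i} {r j} (sr j) (≋-sym (≋-trans (rs j) (cong {1ℤ} {r i ℤ.* s j} p)))))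
        to (inj₂ p) = inj₂ (difference (≋-cancelʳ-* {u = s j} {r j} {r i} {ℤ.- r j} (sr j)
          (≋-trans (≋-reflexive (≡.sym (ℤP.neg-involutive (r i ℤ.* s j))))
          (≋-trans (≋-neg (≋-sym (≋-trans (rs j) (cong {1ℤ} {ℤ.- (r i ℤ.* s j)} p)))) (≋-reflexive (ℤP.neg-distribˡ-* (r j) (s j)))))))
        from : i ≡ j → 1ℤ ≡± r i ℤ.* s j [mod n ]
        from ≡.refl = inj₁ (difference (≋-sym (rs i)))

      -- Both products are instances of `convolution`: the first sums over `s` with y = r_i and v =
      -- s_j; the second, after commuting the factors, sums over `r` with y = s_j and v = r_i.
      cHat-inverse : SquareFree n → ∀ {ninv} → fromℕ F n * ninv ≈ 1# →
        IsInverse F m (cosMatrix F n m ζ r s) (cHatMatrix F n m ζ r s ninv)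
      cHat-inverse sf {ninv} n*ninv≈1 = left , right
        where
        left : ∀ i j → mmul F m (cosMatrix F n m ζ r s) (cHatMatrix F n m ζ r s ninv) i j ≈ idM F m i j
        left i j = trans (sumF≈sum m _) (trans
          (sum-cong {m} λ k → *-congˡ (cHat-units {m} {r} reps ninv (r k ℤ.* s j) {s k} {r k} {s j} (sr k)
            (coprime-* {n} {r k} {s j} (proj₁ reps k) (s⊥n j))
            (≋-trans (≋-reflexive (l (s k) (r k) (s j))) (≋-*-inverse (s j) (sr k)))))
          (trans (convolution sf n*ninv≈1 {m} {s} inverse-reps {s j} {r j} (sr j) {r i} (proj₁ reps i)) (δ-reps i j)))
          where
          l : ∀ x y z → x ℤ.* (y ℤ.* z) ≡ (z ℤ.* x) ℤ.* y
          l = solve-∀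
        right : ∀ i j → mmul F m (cHatMatrix F n m ζ r s ninv) (cosMatrix F n m ζ r s) i j ≈ idM F m i j
        right i j = trans (sumF≈sum m _) (trans
          (sum-cong {m} λ k → trans (*-comm _ _) (*-cong (reflexive (≡.cong cos (ℤP.*-comm (r k) (s j))))
            (cHat-units {m} {r} reps ninv (r i ℤ.* s k) {r k} {s k} {r i} (rs k)
              (coprime-* {n} {r i} {s k} (proj₁ reps i) (s⊥n k))
              (≋-trans (≋-reflexive (l (r k) (r i) (s k))) (≋-*-inverse (r i) (rs k))))))
          (trans (convolution sf n*ninv≈1 {m} {r} reps {r i} {s i} (rs i) {s j} (s⊥n j))
          (trans (reflexive (≡.cong (λ x → δ n x 1ℤ + δ n x (ℤ.- 1ℤ)) (ℤP.*-comm (s j) (r i)))) (δ-reps i j))))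
          where
          l : ∀ x y z → x ℤ.* (y ℤ.* z) ≡ (y ℤ.* x) ℤ.* z
          l = solve-∀

      -- (n/d)² ≡ 0 (mod n) makes 1 + (n/d) i a unit, with inverse 1 - (n/d) i.
      invertible⇒squareFree : CharZero F → Invertible F m (cosMatrix F n m ζ r s) → SquareFree n
      invertible⇒squareFree charZero (B , CB , _) d 2≤d (divides k n≡k*d²) =
        -- Multiplying the vanishing sum of rows by column `κ 0ℤ` of B gives the number of i with
        -- `κ i` equal to `κ 0ℤ`. It is positive, as i = 0 is counted, and repeated rows only
        -- increase it.
        charZero (proj₁ total) (trans (sym (proj₂ total)) (begin
          ∑mod d (λ i → ⟦ κ i Fin.≟ κ 0ℤ ⟧)
            ≈⟨ ∑mod-cong d (λ i → trans (sym (idM≈⟦⟧ m (κ i) (κ 0ℤ))) (trans (sym (CB (κ i) (κ 0ℤ))) (sumF≈sum m _))) ⟩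
          ∑mod d (λ i → sum {m} λ x → cos (r (κ i) ℤ.* s x) * B x (κ 0ℤ))
            ≈⟨ ∑mod-∑-swap d {m} (λ x i → cos (r (κ i) ℤ.* s x) * B x (κ 0ℤ)) ⟨
          sum {m} (λ x → ∑mod d λ i → cos (r (κ i) ℤ.* s x) * B x (κ 0ℤ))
            ≈⟨ sum-zero {m} (λ x → trans (sym (∑mod-*ʳ d (B x (κ 0ℤ)) _)) (trans (*-congʳ (row-sum x)) (zeroˡ _))) ⟩
          0# ∎))
        where
        -- `T` is n / d, and T² = k n.
        T : ℕ
        T = k ℕ.* d
        Td≡n : T ℕ.* d ≡ n
        Td≡n = ≡.trans (ℕP.*-assoc k d d) (≡.sym n≡k*d²)
        instance
          d≢0 : NonZero d
          d≢0 = ℕ.>-nonZero (ℕP.<-trans (s≤s z≤n) 2≤d)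
        h : ℤ → ℤ
        h i = 1ℤ ℤ.+ + T ℤ.* i
        T*T≋0 : + T ℤ.* + T ≋ 0ℤ [ n ]
        T*T≋0 = ∣⇒≋0 (≡.subst (+ n ℤD.∣_) (ℤP.pos-* T T) (ℤD.∣ᵤ⇒∣ (divides k (≡.trans (ℕP.*-assoc k d T)
          (≡.cong (k ℕ.*_) (≡.trans (ℕP.*-comm d T) Td≡n))))))
        h⊥n : ∀ i → CoprimeTo (h i) n
        h⊥n i = invertible⇒coprime {n} {h i} (1ℤ ℤ.- + T ℤ.* i) (≋-trans (≋-reflexive (l (+ T) i))
          (≋-trans (≋-- (≋-refl {a = 1ℤ}) (≋-* {_} {+ T ℤ.* + T} {0ℤ} {i ℤ.* i} T*T≋0 ≋-refl)) (≋-reflexive (l' i))))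
          where
          l : ∀ t i → (1ℤ ℤ.+ t ℤ.* i) ℤ.* (1ℤ ℤ.- t ℤ.* i) ≡ 1ℤ ℤ.- (t ℤ.* t) ℤ.* (i ℤ.* i)
          l = solve-∀
          l' : ∀ i → 1ℤ ℤ.- 0ℤ ℤ.* (i ℤ.* i) ≡ 1ℤ
          l' = solve-∀
        κ : ℤ → Fin m
        κ i = proj₁ (proj₂ (proj₂ reps) (h i) (h⊥n i))
        total : ∃ λ k → ∑mod d (λ i → ⟦ κ i Fin.≟ κ 0ℤ ⟧) ≈ fromℕ F (suc k)
        total = ∑mod-count d (λ i → κ i Fin.≟ κ 0ℤ) ≡.refl
        e-sum : ∀ x → CoprimeTo x n → ∑mod d (λ i → e (h i ℤ.* x)) ≈ 0#
        -- Passing from i to i + 1 multiplies the summand by e(T x), which is not 1; since T d = n,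
        -- the summand has period d in i.
        e-sum x x⊥n = ∑mod-eigen 1ℤ periodic
          (λ i → trans (reflexive (≡.cong e (l (+ T) i x))) (e-+ (+ T ℤ.* x) (h i ℤ.* x)))
          (e-proper {T} {d} {x} 2≤d Td≡n x⊥n)
          where
          l : ∀ t i x → (1ℤ ℤ.+ t ℤ.* (i ℤ.+ 1ℤ)) ℤ.* x ≡ t ℤ.* x ℤ.+ (1ℤ ℤ.+ t ℤ.* i) ℤ.* x
          l = solve-∀
          periodic : Periodic d (λ i → e (h i ℤ.* x))
          periodic {i} {j} (cong p) = e-periodic (≋-* {_} {h i} {h j} {x} (≋-+ {_} {1ℤ} {1ℤ} {+ T ℤ.* i} {+ T ℤ.* j} (≋-refl {a = 1ℤ})
            (cong (≡.subst₂ ℤD._∣_ (≡.trans (≡.sym (ℤP.pos-* T d)) (≡.cong +_ Td≡n)) (l'' (+ T) i j) (ℤD.*-monoʳ-∣ (+ T) p)))) ≋-refl)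
            where
            l'' : ∀ t i j → t ℤ.* (i ℤ.- j) ≡ t ℤ.* i ℤ.- t ℤ.* j
            l'' = solve-∀
        row-sum : ∀ x → ∑mod d (λ i → cos (r (κ i) ℤ.* s x)) ≈ 0#
        row-sum x = begin
          ∑mod d (λ i → cos (r (κ i) ℤ.* s x))
            -- The representative of `h i` equals it only up to sign, which the even cosine does not
            -- see.
            ≈⟨ ∑mod-cong d (λ i → cos-≡± (≡±-*ʳ {n} {r (κ i)} {h i} (s x) (proj₂ (proj₂ (proj₂ reps) (h i) (h⊥n i))))) ⟩
          ∑mod d (λ i → cos (h i ℤ.* s x))
            ≈⟨ ∑mod-+ d _ _ ⟩
          ∑mod d (λ i → e (h i ℤ.* s x)) + ∑mod d (λ i → e (ℤ.- (h i ℤ.* s x)))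
            ≈⟨ +-cong (e-sum (s x) (s⊥n x)) (trans (∑mod-cong d λ i → reflexive (≡.cong e (ℤP.neg-distribʳ-* (h i) (s x))))
                 (e-sum (ℤ.- s x) (coprime-neg {n} (s x) (s⊥n x)))) ⟩
          0# + 0#
            ≈⟨ +-identityˡ 0# ⟩
          0# ∎

-- The cosines 2 cos(2πk/n) arise for `F` the complex numbers and `ζ` = e^(2πi/n). The family `s`
-- lists the inverses k* and `ninv` is 1/n.
theorem2 : ∀ {c ℓ : Level} (F : CommutativeRing c ℓ) → IsField F → CharZero F →
    (n : ℕ) → 3 ≤ n →
    (ζ : CommutativeRing.Carrier F) → IsPrimitiveRoot F n ζ →
    (m : ℕ) (r : Fin m → ℤ) → IsRepSystem n m r →
    (s : Fin m → ℤ) → (∀ k → (r k Data.Integer.* s k) ≡ Data.Integer.1ℤ [mod n ]) →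
    (ninv : CommutativeRing.Carrier F) →
    CommutativeRing._≈_ F (CommutativeRing._*_ F (fromℕ F n) ninv) (CommutativeRing.1# F) →
    (Invertible F m (cosMatrix F n m ζ r s) ⇔ SquareFree n) ×
    (SquareFree n → IsInverse F m (cosMatrix F n m ζ r s) (cHatMatrix F n m ζ r s ninv))
theorem2 F isField charZero n@(suc _) 3≤n ζ root m r reps s rs ninv n*ninv≈1 =
  mk⇔ (invertible⇒squareFree {m} {r} {s} reps rs′ charZero) (λ sf → cHatMatrix F n m ζ r s ninv , inverse sf) , inverse
  where
  open Cosines F isField n 3≤n ζ root
  rs′ : ∀ k → r k ℤ.* s k ≋ 1ℤ [ n ]
  rs′ k = cong (rs k)
  inverse : SquareFree n → IsInverse F m (cosMatrix F n m ζ r s) (cHatMatrix F n m ζ r s ninv)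
  inverse sf = cHat-inverse {m} {r} {s} reps rs′ sf n*ninv≈1
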